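{- There is an algorithm which, given a circular-arc graph $G$ with $n$ vertices together with a representation of $G$ as the intersection graph of $n$ arcs on a circle, computes in $O(n^2)$ time an induced bipartite subgraph $H$ of $G$ such that $|V(H)|\ge |OPT|-1$, where $OPT$ is a maximum-size induced bipartite subgraph of $G$ and $|OPT|$ is its number of vertices.
   Context: A circular-arc graph is the intersection graph of arcs on a circle: each vertex is represented by an arc, and two vertices are adjacent if and only if the corresponding arcs intersect. Running times count elementary operations, including comparisons of real numbers, at unit cost. -}

module Defs where

open import Level using (_⊔_; suc)
open import Data.Bool.Base using (Bool; true; false; not; if_then_else_)
open import Data.Fin.Base using (Fin; toℕ; fromℕ<)
open import Data.Fin.Subset using (Subset; _∈_; ∣_∣)
open import Data.Maybe.Base as Maybe using (Maybe; just; nothing)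
open import Data.Nat.Base using (ℕ; _+_; _∸_; _*_; _≤_; _≡ᵇ_; _≤ᵇ_)
open import Data.Nat.Properties using (_<?_)
open import Data.Product.Base using (Σ; ∃; _×_; proj₁)
open import Data.Sum.Base using (_⊎_)
open import Data.Vec.Base using (tabulate)
open import Function.Bundles using (_⇔_)
open import Relation.Binary.Bundles using (DecTotalOrder)
open import Relation.Binary.Core using (Rel)
open import Relation.Binary.Definitions using (Symmetric; Irreflexive)
open import Relation.Binary.PropositionalEquality.Core using (_≡_; _≢_; refl)
open import Relation.Nullary.Decidable.Core using (yes; no; ⌊_⌋)
open import Relation.Nullary.Negation.Core using (¬_)

record Graph {v} (V : Set v) g : Set (v ⊔ suc g) where
  field
    Adj    : Rel V g
    sym    : Symmetric Adj
    irrefl : Irreflexive _≡_ Adj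

open Graph public using (Adj)

induced : ∀ {n g} → Graph (Fin n) g → (S : Subset n) → Graph (∃ (_∈ S)) g
induced G S = record
  { Adj    = λ u v → Adj G (proj₁ u) (proj₁ v)
  ; sym    = Graph.sym G
  ; irrefl = λ { refl → Graph.irrefl G refl }
  }

Bipartite : ∀ {v g} {V : Set v} → Graph V g → Set (v ⊔ g)
Bipartite {V = V} G =
  Σ (V → Bool) λ side → ∀ {u v} → Adj G u v → side u ≢ side v

IsMaximumInducedBipartite : ∀ {n g} → Graph (Fin n) g → Subset n → Set g
IsMaximumInducedBipartite G S =
  Bipartite (induced G S) ×
  (∀ S′ → Bipartite (induced G S′) → ∣ S′ ∣ ≤ ∣ S ∣)

-- The circle is cut open at one point, so its points are coordinates in a
-- total order.  Only comparisons of coordinates matter, so an arbitrary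
-- decidable total order stands in for the reals.

module _ {c ℓ₁ ℓ₂} (O : DecTotalOrder c ℓ₁ ℓ₂) where
  open DecTotalOrder O using (Carrier) renaming (_≤_ to _≤ᴼ_)

  -- The closed arc swept out when moving from `start` to `end` in the
  -- positive direction; it passes through the cut when `end` is strictly
  -- below `start`, and is a single point when they are equal.
  record Arc : Set c where
    field
      start end : Carrier

  _∈ᵃ_ : Carrier → Arc → Set ℓ₂
  x ∈ᵃ A = (start ≤ᴼ end × start ≤ᴼ x × x ≤ᴼ end)
         ⊎ (¬ (start ≤ᴼ end) × (start ≤ᴼ x ⊎ x ≤ᴼ end))
    where open Arc A

  Intersect : Arc → Arc → Set (c ⊔ ℓ₂)
  Intersect A B = ∃ λ x → x ∈ᵃ A × x ∈ᵃ B

  Represents : ∀ {n g} → (Fin n → Arc) → Graph (Fin n) g → Set (c ⊔ ℓ₂ ⊔ g)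
  Represents arcs G =
    ∀ i j → i ≢ j → Adj G i j ⇔ Intersect (arcs i) (arcs j)

-- A random access machine, as a structured imperative language.  Registers
-- and arrays hold natural numbers; the arithmetic is addition and truncated
-- subtraction.  The endpoints of the input arcs are read-only and can only
-- be compared with each other.  Every syntax node costs one step each time
-- it is evaluated.

infixl 6 _⊕_ _⊖_
infix  5 _≤ⁿ_ _≤ᵖ_
infix  4 _≔_ _[_]≔_
infixr 3 _⨾_

data Expr : Set where
  con     : ℕ → Expr
  reg     : ℕ → Expr
  arr     : ℕ → Expr → Expr
  _⊕_ _⊖_ : Expr → Expr → Expr

data Endpoint : Set where
  startOf endOf : Expr → Endpoint

data Test : Set where
  _≤ⁿ_ : Expr → Expr → Test
  _≤ᵖ_ : Endpoint → Endpoint → Test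

data Program : Set where
  skip         : Program
  _≔_          : ℕ → Expr → Program
  _[_]≔_       : ℕ → Expr → Expr → Program
  _⨾_          : Program → Program → Program
  branch       : Test → Program → Program → Program
  while        : Test → Program → Program

costᵉ : Expr → ℕ
costᵉ (con k)   = 1
costᵉ (reg r)   = 1
costᵉ (arr a e) = 1 + costᵉ e
costᵉ (e ⊕ f)   = 1 + costᵉ e + costᵉ f
costᵉ (e ⊖ f)   = 1 + costᵉ e + costᵉ f

costᵖ : Endpoint → ℕ
costᵖ (startOf e) = 1 + costᵉ e
costᵖ (endOf e)   = 1 + costᵉ e

costᵗ : Test → ℕ
costᵗ (e ≤ⁿ f) = 1 + costᵉ e + costᵉ f
costᵗ (p ≤ᵖ q) = 1 + costᵖ p + costᵖ q

record State : Set where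
  constructor ⟪_,_⟫
  field
    regs : ℕ → ℕ
    arrs : ℕ → ℕ → ℕ

open State public

_[_↦_] : {A : Set} → (ℕ → A) → ℕ → A → ℕ → A
(f [ i ↦ x ]) j = if i ≡ᵇ j then x else f j

⟦_⟧ᵉ : Expr → State → ℕ
⟦ con k ⟧ᵉ   σ = k
⟦ reg r ⟧ᵉ   σ = regs σ r
⟦ arr a e ⟧ᵉ σ = arrs σ a (⟦ e ⟧ᵉ σ)
⟦ e ⊕ f ⟧ᵉ   σ = ⟦ e ⟧ᵉ σ + ⟦ f ⟧ᵉ σ
⟦ e ⊖ f ⟧ᵉ   σ = ⟦ e ⟧ᵉ σ ∸ ⟦ f ⟧ᵉ σ

module _ {c ℓ₁ ℓ₂} (O : DecTotalOrder c ℓ₁ ℓ₂) {n} (arcs : Fin n → Arc O) where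
  open DecTotalOrder O using (Carrier) renaming (_≤?_ to _≤ᴼ?_)

  arcAt : ℕ → Maybe (Arc O)
  arcAt i with i <? n
  ... | yes i<n = just (arcs (fromℕ< i<n))
  ... | no _    = nothing

  ⟦_⟧ᵖ : Endpoint → State → Maybe Carrier
  ⟦ startOf e ⟧ᵖ σ = Maybe.map Arc.start (arcAt (⟦ e ⟧ᵉ σ))
  ⟦ endOf e ⟧ᵖ   σ = Maybe.map Arc.end (arcAt (⟦ e ⟧ᵉ σ))

  -- A comparison involving a nonexistent arc fails.
  compare : Maybe Carrier → Maybe Carrier → Bool
  compare (just x) (just y) = ⌊ x ≤ᴼ? y ⌋
  compare _        _        = false

  ⟦_⟧ᵗ : Test → State → Bool
  ⟦ e ≤ⁿ f ⟧ᵗ σ = ⟦ e ⟧ᵉ σ ≤ᵇ ⟦ f ⟧ᵉ σ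
  ⟦ p ≤ᵖ q ⟧ᵗ σ = compare (⟦ p ⟧ᵖ σ) (⟦ q ⟧ᵖ σ)

  -- Run P σ t τ: started in σ, the program P halts in τ after t steps.
  data Run : Program → State → ℕ → State → Set where
    run-skip : ∀ {σ} → Run skip σ 1 σ

    run-≔ : ∀ {σ r e} →
      Run (r ≔ e) σ (1 + costᵉ e)
          ⟪ regs σ [ r ↦ ⟦ e ⟧ᵉ σ ] , arrs σ ⟫

    run-[]≔ : ∀ {σ a e f} →
      Run (a [ e ]≔ f) σ (1 + costᵉ e + costᵉ f)
          ⟪ regs σ , arrs σ [ a ↦ arrs σ a [ ⟦ e ⟧ᵉ σ ↦ ⟦ f ⟧ᵉ σ ] ] ⟫

    run-⨾ : ∀ {P Q σ τ υ s t} →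
      Run P σ s τ → Run Q τ t υ → Run (P ⨾ Q) σ (1 + s + t) υ

    run-then : ∀ {b P Q σ τ t} → ⟦ b ⟧ᵗ σ ≡ true →
      Run P σ t τ → Run (branch b P Q) σ (1 + costᵗ b + t) τ

    run-else : ∀ {b P Q σ τ t} → ⟦ b ⟧ᵗ σ ≡ false →
      Run Q σ t τ → Run (branch b P Q) σ (1 + costᵗ b + t) τ

    run-done : ∀ {b P σ} → ⟦ b ⟧ᵗ σ ≡ false →
      Run (while b P) σ (1 + costᵗ b) σ

    run-loop : ∀ {b P σ τ υ s t} → ⟦ b ⟧ᵗ σ ≡ true →
      Run P σ s τ → Run (while b P) τ t υ →
      Run (while b P) σ (1 + costᵗ b + s + t) υ

-- Register 0 initially holds the number of arcs; everything else is zero.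
initial : ℕ → State
initial n = ⟪ (λ _ → 0) [ 0 ↦ n ] , (λ _ _ → 0) ⟫

-- The output vertex set consists of the nonzero entries of array 0.
output : ∀ n → State → Subset n
output n σ = tabulate λ i → not (arrs σ 0 (toℕ i) ≡ᵇ 0)

infix 4 _∈O_

_∈O_ : (ℕ → ℕ) → (ℕ → ℕ) → Set
f ∈O g = ∃ λ C → ∃ λ N → ∀ n → N ≤ n → f n ≤ C * g n

{-# OPTIONS --safe #-}

-- In a bipartite induced subgraph no three arcs share a point.  So if w belongs to an optimum, at
-- most one other member contains the start of w; after deleting that member, cutting the circle
-- just before the start of w turns the rest into intervals on a line, no three of which share a
-- point.  For every w, a greedy sweep in order of left endpoints finds a largest 2-colourable set
-- of intervals among w and the arcs avoiding the start of w: it keeps two disjoint families and,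
-- whenever three intervals meet, drops the one with the latest end.  It is optimal because for all
-- t it has selected at least as many intervals ending before t as any competitor.  Replacing the
-- endpoints by their ranks and sorting the arcs beforehand costs O(n²), and each sweep is linear.

module Submission where

open import Defs
open import Data.Bool.Base using (Bool; true; false; not; _∧_; _∨_; if_then_else_; T)
open import Data.Bool.Properties using (T-∧; T-∨; T-≡)
open import Data.Empty using (⊥; ⊥-elim)
open import Data.Fin.Base using (Fin; toℕ; fromℕ<; zero; suc)
open import Data.Fin.Properties using (toℕ<n; toℕ-injective; fromℕ<-toℕ; toℕ-fromℕ<)
open import Data.Fin.Subset using (Subset; _∈_; ∣_∣)
open import Data.Maybe.Base as Maybe using (Maybe; just; nothing)
open import Data.Nat.Base hiding (compare)
open import Data.Nat.Properties
open import Data.Product.Base using (∃; _×_; _,_; proj₁; proj₂)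
open import Data.Sum.Base using (_⊎_; inj₁; inj₂; [_,_]′)
open import Data.Unit.Base using (tt)
open import Data.Vec.Base using (lookup; _∷_; []; here; there)
open import Data.Vec.Properties using ([]=⇒lookup; lookup∘tabulate)
open import Function.Base using (id; _∘_)
open import Function.Bundles using (module Equivalence)
open import Relation.Binary.Bundles using (DecTotalOrder)
open import Relation.Binary.PropositionalEquality
open import Relation.Nullary.Decidable.Core using (yes; no; toWitnessFalse; fromWitnessFalse)
open import Relation.Nullary.Negation.Core using (¬_; contradiction)

-- Structured programs

-- The one arc is lost to the circle, not to the greedy choice. On a line, intervals of which no
-- three share a point always split into two disjoint families, so a competitor of the sweep only
-- has to be free of such triples (`Thin`); no colouring of it enters the comparison. On a circle
-- this fails: an odd cycle of arcs around the circle has no common triple and is not bipartite.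
-- Cutting at the start of a member `w` makes opening the circle cheap, since two further members
-- through that point would form a triangle with `w`. As `w` is unknown, every arc is tried, which
-- leaves linear time per cut. Hence the sorted list is never rotated: for a cut at `σ` it is read
-- twice, once for the arcs starting after `σ` and once, shifted by `M`, for those starting before
-- it. Positions therefore live in the window from `σ` to `σ + M`. The running time is read off the
-- syntax: every loop is bounded by `n` or by `M`, which is 2n + 1, and loops are nested at most two
-- deep.

∧-fst : ∀ {x y} → T (x ∧ y) → T x
∧-fst p = proj₁ (Equivalence.to T-∧ p)

∧-snd : ∀ {x y} → T (x ∧ y) → T y
∧-snd {x} p = proj₂ (Equivalence.to (T-∧ {x}) p)

infixr 3 _⨟_

data Prog : Set where
  nop : Prog
  set : ℕ → Expr → Prog
  put : ℕ → Expr → Expr → Prog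
  _⨟_ : Prog → Prog → Prog
  cond : Test → Prog → Prog → Prog
  -- for r b P runs P for r = 0, …, (contents of register b) − 1.
  for : ℕ → ℕ → Prog → Prog

compile : Prog → Program
compile nop          = skip
compile (set r e)    = r ≔ e
compile (put a e f)  = a [ e ]≔ f
compile (P ⨟ Q)      = compile P ⨾ compile Q
compile (cond b P Q) = branch b (compile P) (compile Q)
compile (for r b P)  =
  r ≔ con 0 ⨾ while (reg r ⊕ con 1 ≤ⁿ reg b) (compile P ⨾ r ≔ reg r ⊕ con 1)

keepsReg keepsArr : ℕ → Prog → Bool
keepsReg x nop          = true
keepsReg x (set r e)    = not (r ≡ᵇ x)
keepsReg x (put a e f)  = true
keepsReg x (P ⨟ Q)      = keepsReg x P ∧ keepsReg x Q
keepsReg x (cond b P Q) = keepsReg x P ∧ keepsReg x Q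
keepsReg x (for r b P)  = not (r ≡ᵇ x) ∧ keepsReg x P

keepsArr x nop          = true
keepsArr x (set r e)    = true
keepsArr x (put a e f)  = not (a ≡ᵇ x)
keepsArr x (P ⨟ Q)      = keepsArr x P ∧ keepsArr x Q
keepsArr x (cond b P Q) = keepsArr x P ∧ keepsArr x Q
keepsArr x (for r b P)  = keepsArr x P

-- The loop bounds of a well-formed program live in registers 0 and 1, which it never overwrites.
wf : Prog → Bool
wf nop          = true
wf (set r e)    = not (r <ᵇ 2)
wf (put a e f)  = true
wf (P ⨟ Q)      = wf P ∧ wf Q
wf (cond b P Q) = wf P ∧ wf Q
wf (for r b P)  = not (r <ᵇ 2) ∧ (b <ᵇ 2) ∧ keepsReg r P ∧ wf P

not-fixed : ∀ r b → T (not (r <ᵇ 2)) → T (b <ᵇ 2) → T (not (r ≡ᵇ b))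
not-fixed (suc (suc r)) zero          p q = tt
not-fixed (suc (suc r)) (suc zero)    p q = tt

wf-keeps : ∀ P {b} → T (wf P) → T (b <ᵇ 2) → T (keepsReg b P)
wf-keeps nop          w q = tt
wf-keeps (set r e)    {b} w q = not-fixed r b w q
wf-keeps (put a e f)  w q = tt
wf-keeps (P ⨟ P′)     w q = Equivalence.from T-∧
  (wf-keeps P (∧-fst w) q , wf-keeps P′ (∧-snd {wf P} w) q)
wf-keeps (cond t P P′) w q = Equivalence.from T-∧
  (wf-keeps P (∧-fst w) q , wf-keeps P′ (∧-snd {wf P} w) q)
wf-keeps (for r c P)  {b} w q = Equivalence.from T-∧
  ( not-fixed r b (∧-fst w) q
  , wf-keeps P (∧-snd {keepsReg r P} (∧-snd {c <ᵇ 2} (∧-snd {not (r <ᵇ 2)} w))) q)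

-- The time bound is `factor P * m ^ degree P`, where `m` bounds registers 0 and 1, so `degree` is
-- the nesting depth of loops. The constant 20 of a loop is 9 + 11: 9 steps are spent once
-- (initialising the counter, sequencing, the last test) and 11 in each iteration besides the body.
factor degree : Prog → ℕ
factor nop          = 1
factor (set r e)    = 1 + costᵉ e
factor (put a e f)  = 1 + costᵉ e + costᵉ f
factor (P ⨟ Q)      = 1 + factor P + factor Q
factor (cond b P Q) = 1 + costᵗ b + (factor P + factor Q)
factor (for r b P)  = 20 + factor P

degree nop          = 0
degree (set r e)    = 0
degree (put a e f)  = 0
degree (P ⨟ Q)      = degree P ⊔ degree Q
degree (cond b P Q) = degree P ⊔ degree Q
degree (for r b P)  = suc (degree P)

update-other : ∀ {A : Set} (f : ℕ → A) i x j → T (not (i ≡ᵇ j)) → (f [ i ↦ x ]) j ≡ f j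
update-other f i x j p with i ≡ᵇ j
... | false = refl

≡ᵇ-refl : ∀ i → (i ≡ᵇ i) ≡ true
≡ᵇ-refl zero    = refl
≡ᵇ-refl (suc i) = ≡ᵇ-refl i

update-same : ∀ {A : Set} (f : ℕ → A) i x → (f [ i ↦ x ]) i ≡ x
update-same f i x rewrite ≡ᵇ-refl i = refl

update-≢ : ∀ {A : Set} (f : ℕ → A) i x j → i ≢ j → (f [ i ↦ x ]) j ≡ f j
update-≢ f i x j i≢j with i ≡ᵇ j in eq
... | false = refl
... | true  = ⊥-elim (i≢j (≡ᵇ⇒≡ i j (subst T (sym eq) tt)))

store : ℕ → ℕ → State → State
store r x σ = ⟪ regs σ [ r ↦ x ] , arrs σ ⟫

iterate : (State → State) → ℕ → ℕ → State → State
iterate f r zero    σ = store r 0 σ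
iterate f r (suc k) σ = let τ = f (iterate f r k σ) in store r (regs τ r + 1) τ

module Semantics {c ℓ₁ ℓ₂} (O : DecTotalOrder c ℓ₁ ℓ₂) {n} (arcs : Fin n → Arc O) where

  -- A total semantics in which the number of iterations is fixed on entering a loop, whereas the
  -- compiled `while` rereads the bound before each iteration. `run` shows that the two agree on
  -- well-formed programs.
  exec : Prog → State → State
  exec nop          σ = σ
  exec (set r e)    σ = store r (⟦ e ⟧ᵉ σ) σ
  exec (put a e f)  σ = ⟪ regs σ , arrs σ [ a ↦ arrs σ a [ ⟦ e ⟧ᵉ σ ↦ ⟦ f ⟧ᵉ σ ] ] ⟫
  exec (P ⨟ Q)      σ = exec Q (exec P σ)
  exec (cond b P Q) σ = if ⟦_⟧ᵗ O arcs b σ then exec P σ else exec Q σ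
  exec (for r b P)  σ = iterate (exec P) r (regs σ b) σ

  exec-reg : ∀ P x → T (keepsReg x P) → ∀ σ → regs (exec P σ) x ≡ regs σ x
  exec-reg nop          x p σ = refl
  exec-reg (set r e)    x p σ = update-other (regs σ) r _ x p
  exec-reg (put a e f)  x p σ = refl
  exec-reg (P ⨟ Q)      x p σ =
    trans (exec-reg Q x (∧-snd {keepsReg x P} p) (exec P σ)) (exec-reg P x (∧-fst p) σ)
  exec-reg (cond b P Q) x p σ with ⟦_⟧ᵗ O arcs b σ
  ... | true  = exec-reg P x (∧-fst p) σ
  ... | false = exec-reg Q x (∧-snd {keepsReg x P} p) σ
  exec-reg (for r b P)  x p σ = go (regs σ b)
    where
    go : ∀ k → regs (iterate (exec P) r k σ) x ≡ regs σ x
    go zero    = update-other (regs σ) r 0 x (∧-fst p)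
    go (suc k) = let τ = exec P (iterate (exec P) r k σ) in
      trans (update-other (regs τ) r _ x (∧-fst p))
        (trans (exec-reg P x (∧-snd {not (r ≡ᵇ x)} p) _) (go k))

  exec-arr : ∀ P x → T (keepsArr x P) → ∀ σ → arrs (exec P σ) x ≡ arrs σ x
  exec-arr nop          x p σ = refl
  exec-arr (set r e)    x p σ = refl
  exec-arr (put a e f)  x p σ = update-other (arrs σ) a _ x p
  exec-arr (P ⨟ Q)      x p σ =
    trans (exec-arr Q x (∧-snd {keepsArr x P} p) (exec P σ)) (exec-arr P x (∧-fst p) σ)
  exec-arr (cond b P Q) x p σ with ⟦_⟧ᵗ O arcs b σ
  ... | true  = exec-arr P x (∧-fst p) σ
  ... | false = exec-arr Q x (∧-snd {keepsArr x P} p) σ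
  exec-arr (for r b P)  x p σ = go (regs σ b)
    where
    go : ∀ k → arrs (iterate (exec P) r k σ) x ≡ arrs σ x
    go zero    = refl
    go (suc k) = trans (exec-arr P x p _) (go k)

  iterate-counter : ∀ P r → T (keepsReg r P) → ∀ k σ → regs (iterate (exec P) r k σ) r ≡ k
  iterate-counter P r p zero    σ = update-same (regs σ) r 0
  iterate-counter P r p (suc k) σ = let τ = exec P (iterate (exec P) r k σ) in
    trans (update-same (regs τ) r (regs τ r + 1))
      (trans (+-comm (regs τ r) 1)
        (cong suc (trans (exec-reg P r p _) (iterate-counter P r p k σ))))

  -- The step receives, besides the invariant, that everything the loop does not write still has its
  -- value from before the loop. These facts are decided by `keepsReg` and `keepsArr`, so `I` only
  -- has to describe what the body changes.
  for-invariant : ∀ {ℓ} r b P σ (I : ℕ → State → Set ℓ) → T (keepsReg r P) →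
    I 0 (store r 0 σ) →
    (∀ k τ → k < regs σ b → regs τ r ≡ k →
      (∀ x → T (keepsReg x (for r b P)) → regs τ x ≡ regs σ x) →
      (∀ a → T (keepsArr a P) → arrs τ a ≡ arrs σ a) →
      I k τ → let υ = exec P τ in I (suc k) (store r (regs υ r + 1) υ)) →
    I (regs σ b) (exec (for r b P) σ)
  for-invariant r b P σ I keep base step = go (regs σ b) ≤-refl
    where
    frameʳ : ∀ k x → T (keepsReg x (for r b P)) → regs (iterate (exec P) r k σ) x ≡ regs σ x
    frameʳ zero    x p = update-other (regs σ) r 0 x (∧-fst p)
    frameʳ (suc k) x p = let τ = exec P (iterate (exec P) r k σ) in
      trans (update-other (regs τ) r _ x (∧-fst p))
        (trans (exec-reg P x (∧-snd {not (r ≡ᵇ x)} p) _) (frameʳ k x p))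
    frameᵃ : ∀ k a → T (keepsArr a P) → arrs (iterate (exec P) r k σ) a ≡ arrs σ a
    frameᵃ zero    a p = refl
    frameᵃ (suc k) a p = trans (exec-arr P a p _) (frameᵃ k a p)
    go : ∀ k → k ≤ regs σ b → I k (iterate (exec P) r k σ)
    go zero    _   = base
    go (suc k) k<N = step k _ k<N (iterate-counter P r keep k σ) (frameʳ k) (frameᵃ k)
                       (go k (<⇒≤ k<N))

  cond-elim : ∀ {ℓ} (R : State → Set ℓ) t P Q σ →
    (⟦_⟧ᵗ O arcs t σ ≡ true → R (exec P σ)) → (⟦_⟧ᵗ O arcs t σ ≡ false → R (exec Q σ)) →
    R (exec (cond t P Q) σ)
  cond-elim R t P Q σ f g with ⟦_⟧ᵗ O arcs t σ
  ... | true  = f refl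
  ... | false = g refl

  cond-≤ : ∀ {ℓ} (R : State → Set ℓ) e f P Q σ →
    (⟦ e ⟧ᵉ σ ≤ ⟦ f ⟧ᵉ σ → R (exec P σ)) → (⟦ f ⟧ᵉ σ < ⟦ e ⟧ᵉ σ → R (exec Q σ)) →
    R (exec (cond (e ≤ⁿ f) P Q) σ)
  cond-≤ R e f P Q σ g h = cond-elim R (e ≤ⁿ f) P Q σ
    (λ eq → g (≤ᵇ⇒≤ _ _ (Equivalence.from T-≡ eq)))
    (λ eq → h (≰⇒> (λ le → subst T eq (≤⇒≤ᵇ le))))

  private
    pow : ∀ m .{{_ : NonZero m}} {d e} → d ≤ e → ∀ k → k * m ^ d ≤ k * m ^ e
    pow m d≤e k = *-monoʳ-≤ k (^-monoʳ-≤ m d≤e)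

    one : ∀ m .{{_ : NonZero m}} d → 1 ≤ m ^ d
    one m d = >-nonZero⁻¹ (m ^ d) {{m^n≢0 m d}}

    const≤ : ∀ m .{{_ : NonZero m}} d k → k ≤ k * m ^ d
    const≤ m d k = ≤-trans (≤-reflexive (sym (*-identityʳ k))) (*-monoʳ-≤ k (one m d))

  -- Registers 0 and 1 are never written (`wf-keeps`), so the bound `m` on them is inherited by
  -- every subprogram and limits all loops alike.
  run : ∀ P → T (wf P) → ∀ m .{{_ : NonZero m}} σ →
    (∀ b → T (b <ᵇ 2) → regs σ b ≤ m) →
    ∃ λ t → Run O arcs (compile P) σ t (exec P σ) × t ≤ factor P * m ^ degree P
  run nop          w m σ h = _ , run-skip , ≤-refl
  run (set r e)    w m σ h = _ , run-≔ , const≤ m 0 (1 + costᵉ e)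
  run (put a e f)  w m σ h = _ , run-[]≔ , const≤ m 0 (1 + costᵉ e + costᵉ f)
  run (P ⨟ Q)      w m σ h
    with run P (∧-fst w) m σ h
       | run Q (∧-snd {wf P} w) m (exec P σ)
           (λ b q → ≤-trans (≤-reflexive (exec-reg P b (wf-keeps P (∧-fst w) q) σ)) (h b q))
  ... | s , runP , s≤ | t , runQ , t≤ = _ , run-⨾ runP runQ , bound
    where
    D = degree P ⊔ degree Q
    open ≤-Reasoning
    bound : 1 + s + t ≤ (1 + factor P + factor Q) * m ^ D
    bound = begin
      1 + s + t
        ≤⟨ +-mono-≤ (+-mono-≤ (const≤ m D 1) (≤-trans s≤ (pow m (m≤m⊔n (degree P) (degree Q)) (factor P))))
                    (≤-trans t≤ (pow m (m≤n⊔m (degree P) (degree Q)) (factor Q))) ⟩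
      1 * m ^ D + factor P * m ^ D + factor Q * m ^ D
        ≡⟨ cong (_+ factor Q * m ^ D) (*-distribʳ-+ (m ^ D) 1 (factor P)) ⟨
      (1 + factor P) * m ^ D + factor Q * m ^ D
        ≡⟨ *-distribʳ-+ (m ^ D) (1 + factor P) (factor Q) ⟨
      (1 + factor P + factor Q) * m ^ D ∎
  run (cond b P Q) w m σ h = go _ refl
    where
    D = degree P ⊔ degree Q
    open ≤-Reasoning
    bound : ∀ s F d → d ≤ D → F ≤ factor P + factor Q → s ≤ F * m ^ d →
            1 + costᵗ b + s ≤ (1 + costᵗ b + (factor P + factor Q)) * m ^ D
    bound s F d d≤D F≤ s≤ = begin
      1 + costᵗ b + s
        ≤⟨ +-mono-≤ (const≤ m D (1 + costᵗ b))
             (≤-trans s≤ (≤-trans (pow m d≤D F) (*-monoˡ-≤ (m ^ D) F≤))) ⟩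
      (1 + costᵗ b) * m ^ D + (factor P + factor Q) * m ^ D
        ≡⟨ *-distribʳ-+ (m ^ D) (1 + costᵗ b) (factor P + factor Q) ⟨
      (1 + costᵗ b + (factor P + factor Q)) * m ^ D ∎
    go : ∀ v → ⟦_⟧ᵗ O arcs b σ ≡ v →
         ∃ λ t → Run O arcs (branch b (compile P) (compile Q)) σ t (exec (cond b P Q) σ)
               × t ≤ (1 + costᵗ b + (factor P + factor Q)) * m ^ D
    go true eq with run P (∧-fst w) m σ h
    ... | s , r , s≤ =
      _ , subst (λ v → Run O arcs _ σ _ (if v then exec P σ else exec Q σ)) (sym eq) (run-then eq r)
        , bound s (factor P) (degree P) (m≤m⊔n _ _) (m≤m+n _ _) s≤
    go false eq with run Q (∧-snd {wf P} w) m σ h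
    ... | s , r , s≤ =
      _ , subst (λ v → Run O arcs _ σ _ (if v then exec P σ else exec Q σ)) (sym eq) (run-else eq r)
        , bound s (factor Q) (degree Q) (m≤n⊔m _ _) (m≤n+m _ _) s≤
  run (for r b P)  w m σ h with go (regs σ b) 0 (+-identityʳ _)
    where
    w-b   = ∧-fst (∧-snd {not (r <ᵇ 2)} w)
    w-P   = ∧-snd {b <ᵇ 2} (∧-snd {not (r <ᵇ 2)} w)
    keep  = ∧-fst {keepsReg r P} w-P
    N     = regs σ b
    K     = factor P * m ^ degree P
    at    = λ k → iterate (exec P) r k σ
    fixed : ∀ k x → T (x <ᵇ 2) → regs (at k) x ≡ regs σ x
    fixed zero    x q = update-other (regs σ) r 0 x (not-fixed r x (∧-fst w) q)
    fixed (suc k) x q = trans (update-other (regs (exec P (at k))) r _ x (not-fixed r x (∧-fst w) q))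
      (trans (exec-reg P x (wf-keeps P (∧-snd {keepsReg r P} w-P) q) _) (fixed k x q))
    test  = reg r ⊕ con 1 ≤ⁿ reg b
    -- `d` counts the iterations still to come. A test costs 6, and the failing one is paid at the
    -- end; an iteration costs 6 for its test, 1 for sequencing and 4 for the increment, besides at
    -- most `K` for the body.
    go : ∀ d k → d + k ≡ N →
         ∃ λ t → Run O arcs (while test (compile P ⨾ r ≔ reg r ⊕ con 1)) (at k) t (at N)
               × t ≤ 6 + d * (11 + K)
    go zero k refl = _ ,
      run-done (trans (cong₂ (λ x y → x + 1 ≤ᵇ y) (iterate-counter P r keep k σ) (fixed k b w-b)) stops) ,
      ≤-refl
      where
      stops : (k + 1 ≤ᵇ k) ≡ false
      stops with k + 1 ≤ᵇ k in eq
      ... | false = refl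
      ... | true  = ⊥-elim (<-irrefl refl
        (≤-trans (≤-reflexive (+-comm 1 k)) (≤ᵇ⇒≤ (k + 1) k (subst T (sym eq) tt))))
    go (suc d) k e
      with run P (∧-snd {keepsReg r P} w-P) m (at k)
             (λ x q → ≤-trans (≤-reflexive (fixed k x q)) (h x q))
         | go d (suc k) (trans (+-suc d k) e)
    ... | s , runP , s≤ | t , runW , t≤ =
      _ , run-loop (trans (cong₂ (λ x y → x + 1 ≤ᵇ y) (iterate-counter P r keep k σ) (fixed k b w-b)) goes)
            (run-⨾ runP run-≔) runW
        , bound
      where
      goes : (k + 1 ≤ᵇ N) ≡ true
      goes = Equivalence.to T-≡
        (≤⇒≤ᵇ (≤-trans (≤-reflexive (+-comm k 1)) (≤-trans (s≤s (m≤n+m k d)) (≤-reflexive e))))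
      open ≤-Reasoning
      bound : 6 + (1 + s + 4) + t ≤ 6 + suc d * (11 + K)
      bound = begin
        6 + (1 + s + 4) + t
          ≡⟨ cong (λ x → 6 + suc x + t) (+-comm s 4) ⟩
        11 + s + t
          ≤⟨ +-mono-≤ (+-monoʳ-≤ 11 s≤) t≤ ⟩
        11 + K + (6 + d * (11 + K))
          ≡⟨ cong (11 +_) (trans (sym (+-assoc K 6 _))
               (trans (cong (_+ d * (11 + K)) (+-comm K 6)) (+-assoc 6 K _))) ⟩
        6 + suc d * (11 + K) ∎
  ... | t , runW , t≤ = _ , run-⨾ run-≔ runW , bound
    where
    F = factor P
    D = degree P
    open ≤-Reasoning
    bound : 3 + t ≤ (20 + F) * m ^ suc D
    bound = begin
      3 + t                            ≤⟨ +-monoʳ-≤ 3 t≤ ⟩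
      9 + regs σ b * (11 + F * m ^ D)
        ≤⟨ +-monoʳ-≤ 9 (*-monoˡ-≤ (11 + F * m ^ D) (h b (∧-fst (∧-snd {not (r <ᵇ 2)} w)))) ⟩
      9 + m * (11 + F * m ^ D)
        ≤⟨ +-mono-≤ (const≤ m (suc D) 9) (*-monoʳ-≤ m (+-monoˡ-≤ (F * m ^ D) (const≤ m D 11))) ⟩
      9 * m ^ suc D + m * (11 * m ^ D + F * m ^ D)
        ≡⟨ cong (λ x → 9 * m ^ suc D + m * x) (*-distribʳ-+ (m ^ D) 11 F) ⟨
      9 * m ^ suc D + m * ((11 + F) * m ^ D)
        ≡⟨ cong (9 * m ^ suc D +_) (trans (sym (*-assoc m (11 + F) _))
             (trans (cong (_* m ^ D) (*-comm m (11 + F))) (*-assoc (11 + F) m _))) ⟩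
      9 * m ^ suc D + (11 + F) * m ^ suc D
        ≡⟨ *-distribʳ-+ (m ^ suc D) 9 (11 + F) ⟨
      (20 + F) * m ^ suc D ∎

-- Counting

∧-intro : ∀ {x y} → T x → T y → T (x ∧ y)
∧-intro p q = Equivalence.from T-∧ (p , q)

T-not : ∀ {x} → T (not x) → ¬ T x
T-not {false} _ h = h

not-T : ∀ {x} → ¬ T x → T (not x)
not-T {false} _ = tt
not-T {true}  h = h tt

bit : Bool → ℕ
bit b = if b then 1 else 0

count : (ℕ → Bool) → ℕ → ℕ
count p zero    = 0
count p (suc n) = bit (p n) + count p n

bit-mono : ∀ {x y} → (T x → T y) → bit x ≤ bit y
bit-mono {false}        f = z≤n
bit-mono {true} {true}  f = ≤-refl
bit-mono {true} {false} f = ⊥-elim (f tt)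

bit-true : ∀ {x} → T x → bit x ≡ 1
bit-true {true} p = refl

bit-false : ∀ {x} → ¬ T x → bit x ≡ 0
bit-false {false} p = refl
bit-false {true}  p = ⊥-elim (p tt)

count-mono : ∀ {p q} n → (∀ k → k < n → T (p k) → T (q k)) → count p n ≤ count q n
count-mono zero    f = z≤n
count-mono (suc n) f =
  +-mono-≤ (bit-mono (f n ≤-refl)) (count-mono n (λ k k<n → f k (m<n⇒m<1+n k<n)))

count-cong : ∀ {p q} n → (∀ k → k < n → p k ≡ q k) → count p n ≡ count q n
count-cong zero    f = refl
count-cong (suc n) f =
  cong₂ (λ x y → bit x + y) (f n ≤-refl) (count-cong n (λ k k<n → f k (m<n⇒m<1+n k<n)))

count≤ : ∀ p n → count p n ≤ n
count≤ p zero    = z≤n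
count≤ p (suc n) = +-mono-≤ (bit-mono {p n} {true} _) (count≤ p n)

count-none : ∀ {p} n → (∀ k → k < n → ¬ T (p k)) → count p n ≡ 0
count-none zero    f = refl
count-none (suc n) f =
  cong₂ _+_ (bit-false (f n ≤-refl)) (count-none n (λ k k<n → f k (m<n⇒m<1+n k<n)))

count-insert : ∀ {p q} n j → j < n → ¬ T (p j) → T (q j) →
  (∀ k → k < n → T (p k) → T (q k)) → suc (count p n) ≤ count q n
count-insert {p} {q} (suc n) j j<n pj qj f with m≤n⇒m<n∨m≡n (s≤s⁻¹ j<n)
... | inj₂ refl rewrite bit-false pj | bit-true qj =
  s≤s (count-mono n (λ k k<n → f k (m<n⇒m<1+n k<n)))
... | inj₁ j<n′ = ≤-trans (≤-reflexive (sym (+-suc (bit (p n)) _)))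
  (+-mono-≤ (bit-mono (f n ≤-refl)) (count-insert n j j<n′ pj qj (λ k k<n → f k (m<n⇒m<1+n k<n))))

bit-union : ∀ {x y z} → (T x → T y ⊎ T z) → bit x ≤ bit y + bit z
bit-union {false}                f = z≤n
bit-union {true} {true}          f = s≤s z≤n
bit-union {true} {false} {true}  f = ≤-refl
bit-union {true} {false} {false} f = ⊥-elim ([ id , id ]′ (f tt))

count-union : ∀ {r p q} n → (∀ k → k < n → T (r k) → T (p k) ⊎ T (q k)) →
  count r n ≤ count p n + count q n
count-union zero    f = z≤n
count-union {r} {p} {q} (suc n) f = ≤-trans
  (+-mono-≤ (bit-union (f n ≤-refl)) (count-union n (λ k k<n → f k (m<n⇒m<1+n k<n))))
  (≤-reflexive (+-interchange (bit (p n)) (bit (q n)) (count p n) (count q n)))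
  where
  open import Algebra.Properties.CommutativeSemigroup +-commutativeSemigroup
    renaming (interchange to +-interchange)

-- The index found is the largest one, so the remaining `m` lie strictly below it, and repeated
-- picking yields distinct indices.
count-pick : ∀ {p} n {m} → suc m ≤ count p n → ∃ λ i → i < n × T (p i) × m ≤ count p i
count-pick {p} (suc n) h with p n in eq
... | true  = n , ≤-refl , Equivalence.from T-≡ eq , s≤s⁻¹ h
... | false with count-pick n h
...   | i , i<n , pi , h′ = i , m<n⇒m<1+n i<n , pi , h′

count≤1 : ∀ {p} n → (∀ i j → i < n → j < n → i ≢ j → T (p i) → T (p j) → ⊥) → count p n ≤ 1
count≤1 {p} n f with count p n ≤? 1
... | yes h = h
... | no ¬h with count-pick n (≰⇒> ¬h)
...   | i , i<n , pi , h with count-pick i h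
...     | j , j<i , pj , _ = ⊥-elim (f i j i<n (<-trans j<i i<n) (>⇒≢ j<i) pi pj)

count≤2 : ∀ {p} n →
  (∀ i j k → i < n → j < n → k < n → i ≢ j → i ≢ k → j ≢ k → T (p i) → T (p j) → T (p k) → ⊥) →
  count p n ≤ 2
count≤2 {p} n f with count p n ≤? 2
... | yes h = h
... | no ¬h with count-pick n (≰⇒> ¬h)
...   | i , i<n , pi , h with count-pick i h
...     | j , j<i , pj , h′ with count-pick j h′
...       | k , k<j , pk , _ = ⊥-elim (f i j k i<n (<-trans j<i i<n) (<-trans k<j (<-trans j<i i<n))
              (>⇒≢ j<i) (>⇒≢ (<-trans k<j j<i)) (>⇒≢ k<j) pi pj pk)

bit-split : ∀ x p → bit (x <ᵇ suc p) ≡ bit (x <ᵇ p) + bit (x ≡ᵇ p)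
bit-split zero    zero    = refl
bit-split zero    (suc p) = refl
bit-split (suc x) zero    = refl
bit-split (suc x) (suc p) = bit-split x p

count-sum : ∀ {r p q : ℕ → Bool} n → (∀ k → bit (r k) ≡ bit (p k) + bit (q k)) →
  count r n ≡ count p n + count q n
count-sum zero    f = refl
count-sum {r} {p} {q} (suc n) f = trans (cong₂ _+_ (f n) (count-sum {r} {p} {q} n f))
  (interchange (bit (p n)) (bit (q n)) (count p n) (count q n))
  where open import Algebra.Properties.CommutativeSemigroup +-commutativeSemigroup using (interchange)

count-all : ∀ {p} n → (∀ k → k < n → T (p k)) → count p n ≡ n
count-all zero    f = refl
count-all (suc n) f =
  cong₂ _+_ (bit-true (f n ≤-refl)) (count-all n (λ k k<n → f k (m<n⇒m<1+n k<n)))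

-- `count` recurses from the top index, while a `Subset` is a vector peeled from index 0; this
-- reconciles the two.
count-front : ∀ p n → count p (suc n) ≡ bit (p 0) + count (p ∘ suc) n
count-front p zero    = refl
count-front p (suc n) = trans (cong (bit (p (suc n)) +_) (count-front p n))
  (trans (sym (+-assoc (bit (p (suc n))) (bit (p 0)) _))
    (trans (cong (_+ count (p ∘ suc) n) (+-comm (bit (p (suc n))) (bit (p 0))))
      (+-assoc (bit (p 0)) (bit (p (suc n))) _)))

∣∣≡count : ∀ {n} (A : Subset n) p → (∀ i → lookup A i ≡ p (toℕ i)) → ∣ A ∣ ≡ count p n
∣∣≡count []       p h = refl
∣∣≡count {suc n} (x ∷ A) p h = trans (step x (h zero)) (sym (count-front p n))
  where
  rec : ∣ A ∣ ≡ count (p ∘ suc) n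
  rec = ∣∣≡count A (p ∘ suc) (λ i → h (suc i))
  step : ∀ x → x ≡ p 0 → ∣ x ∷ A ∣ ≡ bit (p 0) + count (p ∘ suc) n
  step true  e = trans (cong suc rec) (cong (λ b → bit b + count (p ∘ suc) n) e)
  step false e = trans rec (cong (λ b → bit b + count (p ∘ suc) n) e)

indicator : ∀ {n} → Subset n → ℕ → Bool
indicator []      k       = false
indicator (x ∷ A) zero    = x
indicator (x ∷ A) (suc k) = indicator A k

indicator-lookup : ∀ {n} (A : Subset n) i → lookup A i ≡ indicator A (toℕ i)
indicator-lookup (x ∷ A) zero    = refl
indicator-lookup (x ∷ A) (suc i) = indicator-lookup A i

indicator-∈ : ∀ {n} (A : Subset n) {k} → T (indicator A k) → ∃ λ i → toℕ i ≡ k × i ∈ A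
indicator-∈ (true ∷ A) {zero}  h = zero , refl , here
indicator-∈ (x ∷ A) {suc k} h = let i , e , m = indicator-∈ A h in suc i , cong suc e , there m

-- The greedy sweep

nonzero : ℕ → Bool
nonzero k = not (k ≡ᵇ 0)

nonzero⇒≢0 : ∀ {k} → T (nonzero k) → k ≢ 0
nonzero⇒≢0 {zero} () refl

≢0⇒nonzero : ∀ {k} → k ≢ 0 → T (nonzero k)
≢0⇒nonzero {zero}  p = p refl
≢0⇒nonzero {suc k} p = tt

module Greedy (n : ℕ) (A B : ℕ → ℕ) (V : ℕ → Set) (A≤B : ∀ {k} → V k → A k ≤ B k) where

  record Proper (sel : ℕ → ℕ) : Set where
    field
      colours : ∀ k → sel k ≤ 2
      support : ∀ k → sel k ≢ 0 → k < n × V k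
      apart   : ∀ j k → j ≢ k → sel j ≡ sel k → sel j ≢ 0 → B j < A k ⊎ B k < A j

  -- cur is the left end point reached by the sweep.  An empty slot has e < cur.
  record Slot (cur : ℕ) (sel : ℕ → ℕ) (i e c : ℕ) : Set where
    field
      c≢0  : c ≢ 0
      c≤2  : c ≤ 2
      real : e < cur ⊎ (sel i ≡ c × B i ≡ e)
      rest : ∀ k → sel k ≡ c → B k < cur ⊎ (k ≡ i × B k ≡ e)

  record Inv (cur : ℕ) (sel : ℕ → ℕ) (i₀ e₀ c₀ i₁ e₁ c₁ : ℕ) : Set where
    field
      proper : Proper sel
      slot₀  : Slot cur sel i₀ e₀ c₀
      slot₁  : Slot cur sel i₁ e₁ c₁
      c₀≢c₁  : c₀ ≢ c₁

  Inv-swap : ∀ {cur sel i₀ e₀ c₀ i₁ e₁ c₁} →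
    Inv cur sel i₀ e₀ c₀ i₁ e₁ c₁ → Inv cur sel i₁ e₁ c₁ i₀ e₀ c₀
  Inv-swap v = record { proper = proper ; slot₀ = slot₁ ; slot₁ = slot₀ ; c₀≢c₁ = c₀≢c₁ ∘ sym }
    where open Inv v

  Slot-later : ∀ {cur cur′ sel i e c} → cur ≤ cur′ → Slot cur sel i e c → Slot cur′ sel i e c
  Slot-later le s = record
    { c≢0 = c≢0 ; c≤2 = c≤2
    ; real = [ (λ p → inj₁ (<-≤-trans p le)) , inj₂ ]′ real
    ; rest = λ k p → [ (λ q → inj₁ (<-≤-trans q le)) , inj₂ ]′ (rest k p) }
    where open Slot s

  Inv-later : ∀ {cur cur′ sel i₀ e₀ c₀ i₁ e₁ c₁} → cur ≤ cur′ →
    Inv cur sel i₀ e₀ c₀ i₁ e₁ c₁ → Inv cur′ sel i₀ e₀ c₀ i₁ e₁ c₁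
  Inv-later le v = record
    { proper = proper ; slot₀ = Slot-later le slot₀ ; slot₁ = Slot-later le slot₁ ; c₀≢c₁ = c₀≢c₁ }
    where open Inv v

  update-cases : ∀ (sel : ℕ → ℕ) j c k →
    (k ≡ j × (sel [ j ↦ c ]) k ≡ c) ⊎ (j ≢ k × (sel [ j ↦ c ]) k ≡ sel k)
  update-cases sel j c k with j ≟ k
  ... | yes refl = inj₁ (refl , update-same sel j c)
  ... | no j≢k   = inj₂ (j≢k , update-≢ sel j c k j≢k)

  Proper-drop : ∀ {sel} i → Proper sel → Proper (sel [ i ↦ 0 ])
  Proper-drop {sel} i p = record { colours = cl ; support = su ; apart = ap }
    where
    open Proper p
    cl : ∀ k → (sel [ i ↦ 0 ]) k ≤ 2
    cl k with update-cases sel i 0 k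
    ... | inj₁ (_ , e) = ≤-trans (≤-reflexive e) z≤n
    ... | inj₂ (_ , e) = ≤-trans (≤-reflexive e) (colours k)
    su : ∀ k → (sel [ i ↦ 0 ]) k ≢ 0 → k < n × V k
    su k h with update-cases sel i 0 k
    ... | inj₁ (_ , e) = ⊥-elim (h e)
    ... | inj₂ (_ , e) = support k (λ q → h (trans e q))
    ap : ∀ j k → j ≢ k → (sel [ i ↦ 0 ]) j ≡ (sel [ i ↦ 0 ]) k → (sel [ i ↦ 0 ]) j ≢ 0 →
         B j < A k ⊎ B k < A j
    ap j k j≢k eq h with update-cases sel i 0 j | update-cases sel i 0 k
    ... | inj₁ (_ , e) | _            = ⊥-elim (h e)
    ... | inj₂ (_ , e) | inj₁ (_ , f) = ⊥-elim (h (trans eq f))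
    ... | inj₂ (_ , e) | inj₂ (_ , f) =
      apart j k j≢k (trans (sym e) (trans eq f)) (λ q → h (trans e q))

  Slot-drop : ∀ {cur sel i e c} d → sel d ≢ c → Slot cur sel i e c → Slot cur (sel [ d ↦ 0 ]) i e c
  Slot-drop {cur} {sel} {i} {e} {c} d d≢ s = record { c≢0 = c≢0 ; c≤2 = c≤2 ; real = re ; rest = rs }
    where
    open Slot s
    re : e < cur ⊎ ((sel [ d ↦ 0 ]) i ≡ c × B i ≡ e)
    re with real
    ... | inj₁ p = inj₁ p
    ... | inj₂ (p , q) = inj₂ (trans (update-≢ sel d 0 i (λ { refl → d≢ p })) p , q)
    rs : ∀ k → (sel [ d ↦ 0 ]) k ≡ c → B k < cur ⊎ (k ≡ i × B k ≡ e)
    rs k h with update-cases sel d 0 k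
    ... | inj₁ (_ , f) = ⊥-elim (c≢0 (trans (sym h) f))
    ... | inj₂ (_ , f) = rest k (trans (sym f) h)

  module _ {sel : ℕ → ℕ} {j c : ℕ} (j<n : j < n) (Vj : V j) (free : sel j ≡ 0)
           (c≢0 : c ≢ 0) (c≤2 : c ≤ 2) (past : ∀ k → sel k ≡ c → B k < A j) where

    Proper-place : Proper sel → Proper (sel [ j ↦ c ])
    Proper-place p = record { colours = cl ; support = su ; apart = ap }
      where
      open Proper p
      cl : ∀ k → (sel [ j ↦ c ]) k ≤ 2
      cl k with update-cases sel j c k
      ... | inj₁ (_ , e) = ≤-trans (≤-reflexive e) c≤2
      ... | inj₂ (_ , e) = ≤-trans (≤-reflexive e) (colours k)
      su : ∀ k → (sel [ j ↦ c ]) k ≢ 0 → k < n × V k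
      su k h with update-cases sel j c k
      ... | inj₁ (refl , e) = j<n , Vj
      ... | inj₂ (_ , e) = support k (λ q → h (trans e q))
      ap : ∀ i k → i ≢ k → (sel [ j ↦ c ]) i ≡ (sel [ j ↦ c ]) k → (sel [ j ↦ c ]) i ≢ 0 →
           B i < A k ⊎ B k < A i
      ap i k i≢k eq h with update-cases sel j c i | update-cases sel j c k
      ... | inj₁ (refl , e) | inj₁ (refl , f) = ⊥-elim (i≢k refl)
      ... | inj₁ (refl , e) | inj₂ (_ , f) = inj₂ (past k (trans (sym f) (trans (sym eq) e)))
      ... | inj₂ (_ , e) | inj₁ (refl , f) = inj₁ (past i (trans (sym e) (trans eq f)))
      ... | inj₂ (_ , e) | inj₂ (_ , f) =
        apart i k i≢k (trans (sym e) (trans eq f)) (λ q → h (trans e q))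

    Slot-place : Slot (A j) (sel [ j ↦ c ]) j (B j) c
    Slot-place = record { c≢0 = c≢0 ; c≤2 = c≤2 ; real = inj₂ (update-same sel j c , refl) ; rest = rs }
      where
      rs : ∀ k → (sel [ j ↦ c ]) k ≡ c → B k < A j ⊎ (k ≡ j × B k ≡ B j)
      rs k h with update-cases sel j c k
      ... | inj₁ (refl , e) = inj₂ (refl , refl)
      ... | inj₂ (_ , e) = inj₁ (past k (trans (sym e) h))

    Slot-beside : ∀ {cur i e d} → c ≢ d → Slot cur sel i e d → Slot cur (sel [ j ↦ c ]) i e d
    Slot-beside {cur} {i} {e} {d} c≢d s =
      record { c≢0 = Slot.c≢0 s ; c≤2 = Slot.c≤2 s ; real = re ; rest = rs }
      where
      open Slot s
      re : e < cur ⊎ ((sel [ j ↦ c ]) i ≡ d × B i ≡ e)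
      re with real
      ... | inj₁ p = inj₁ p
      ... | inj₂ (p , q) =
        inj₂ (trans (update-≢ sel j c i (λ { refl → Slot.c≢0 s (trans (sym p) free) })) p , q)
      rs : ∀ k → (sel [ j ↦ c ]) k ≡ d → B k < cur ⊎ (k ≡ i × B k ≡ e)
      rs k h with update-cases sel j c k
      ... | inj₁ (_ , f) = ⊥-elim (c≢d (trans (sym f) h))
      ... | inj₂ (_ , f) = rest k (trans (sym f) h)

  module _ {cur sel i₀ e₀ c₀ i₁ e₁ c₁} (v : Inv cur sel i₀ e₀ c₀ i₁ e₁ c₁)
           {j} (j<n : j < n) (Vj : V j) (free : sel j ≡ 0) (later : cur ≤ A j) where
    open Inv v

    Inv-place : e₀ < A j → Inv (A j) (sel [ j ↦ c₀ ]) j (B j) c₀ i₁ e₁ c₁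
    Inv-place e₀<a = record
      { proper = Proper-place j<n Vj free (Slot.c≢0 slot₀) (Slot.c≤2 slot₀) past proper
      ; slot₀  = Slot-place j<n Vj free (Slot.c≢0 slot₀) (Slot.c≤2 slot₀) past
      ; slot₁  = Slot-later later (Slot-beside j<n Vj free (Slot.c≢0 slot₀) (Slot.c≤2 slot₀) past c₀≢c₁ slot₁)
      ; c₀≢c₁  = c₀≢c₁ }
      where
      past : ∀ k → sel k ≡ c₀ → B k < A j
      past k h with Slot.rest slot₀ k h
      ... | inj₁ p = <-≤-trans p later
      ... | inj₂ (_ , p) = ≤-<-trans (≤-reflexive p) e₀<a

    -- An empty slot has `e < cur`, and `cur ≤ A j`; a slot whose end reaches `A j` must therefore
    -- hold a selected arc.
    occupant : ∀ {i e c} → Slot cur sel i e c → A j ≤ e → i < n × sel i ≡ c × B i ≡ e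
    occupant s a≤e with Slot.real s
    ... | inj₁ p = ⊥-elim (<⇒≱ p (≤-trans later a≤e))
    ... | inj₂ (p , q) = proj₁ (Proper.support proper _ (λ z → Slot.c≢0 s (trans (sym p) z))) , p , q

    occupant-≢ : ∀ {i e c} → Slot cur sel i e c → A j ≤ e → i ≢ j
    occupant-≢ s a≤e refl = Slot.c≢0 s (trans (sym (proj₁ (proj₂ (occupant s a≤e)))) free)

    occupants-≢ : A j ≤ e₀ → A j ≤ e₁ → i₀ ≢ i₁
    occupants-≢ a≤e₀ a≤e₁ refl = c₀≢c₁
      (trans (sym (proj₁ (proj₂ (occupant slot₀ a≤e₀)))) (proj₁ (proj₂ (occupant slot₁ a≤e₁))))

    -- By `rest`, the occupant is the only arc of colour `c₁` that can reach beyond `cur`. Once it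
    -- is dropped, the whole class has ended before `A j` and can receive `j`.
    Inv-replace : A j ≤ e₁ → Inv (A j) ((sel [ i₁ ↦ 0 ]) [ j ↦ c₁ ]) i₀ e₀ c₀ j (B j) c₁
    Inv-replace a≤e₁ = record
      { proper = Proper-place j<n Vj free′ (Slot.c≢0 slot₁) (Slot.c≤2 slot₁) past (Proper-drop i₁ proper)
      ; slot₀  = Slot-later later
          (Slot-beside j<n Vj free′ (Slot.c≢0 slot₁) (Slot.c≤2 slot₁) past (c₀≢c₁ ∘ sym)
            (Slot-drop i₁ (λ h → c₀≢c₁ (trans (sym h) (proj₁ (proj₂ (occupant slot₁ a≤e₁))))) slot₀))
      ; slot₁  = Slot-place j<n Vj free′ (Slot.c≢0 slot₁) (Slot.c≤2 slot₁) past
      ; c₀≢c₁  = c₀≢c₁ }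
      where
      free′ : (sel [ i₁ ↦ 0 ]) j ≡ 0
      free′ = trans (update-≢ sel i₁ 0 j (occupant-≢ slot₁ a≤e₁)) free
      past : ∀ k → (sel [ i₁ ↦ 0 ]) k ≡ c₁ → B k < A j
      past k h with update-cases sel i₁ 0 k
      ... | inj₁ (_ , f) = ⊥-elim (Slot.c≢0 slot₁ (trans (sym h) f))
      ... | inj₂ (i₁≢k , f) with Slot.rest slot₁ k (trans (sym f) h)
      ...   | inj₁ p = <-≤-trans p later
      ...   | inj₂ (p , _) = ⊥-elim (i₁≢k (sym p))

  early : (ℕ → Bool) → ℕ → ℕ → Bool
  early p t k = p k ∧ (B k <ᵇ t)

  chosen : (ℕ → ℕ) → ℕ → Bool
  chosen sel k = nonzero (sel k)

  -- The index `j` joins only if `Q` contains it, so one update covers members and non-members of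
  -- `Q` alike.
  add : (ℕ → Bool) → (ℕ → Bool) → ℕ → ℕ → Bool
  add Q q j k = q k ∨ ((k ≡ᵇ j) ∧ Q k)

  -- Triples are tested only at starts `A x`, because the sweep line only stops there. The arc `x`
  -- itself may lie outside `Q`: `crowded` applies `thin` at the start of whichever arc is being
  -- considered.
  module _ (Q : ℕ → Bool)
    (thin : ∀ x i j k → x < n → V x → i < n → j < n → k < n →
            i ≢ j → i ≢ k → j ≢ k → T (Q i) → T (Q j) → T (Q k) →
            A i ≤ A x × A x ≤ B i → A j ≤ A x × A x ≤ B j → A k ≤ A x × A x ≤ B k → ⊥) where

    -- q is the set of members of Q met so far.  Comparing the numbers of arcs that end before
    -- t for every t, instead of just the totals, is what makes this an invariant.
    record Dominates (cur : ℕ) (sel : ℕ → ℕ) (q : ℕ → Bool) : Set where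
      field
        member : ∀ k → T (q k) → T (Q k) × A k ≤ cur
        met    : ∀ k → sel k ≢ 0 → T (Q k) → T (q k)
        ahead  : ∀ t → count (early q t) n ≤ count (early (chosen sel) t) n

    add-⊇ : ∀ q j k → T (q k) → T (add Q q j k)
    add-⊇ q j k h = Equivalence.from T-∨ (inj₁ h)

    add-∋ : ∀ q j → T (Q j) → T (add Q q j j)
    add-∋ q j h = Equivalence.from T-∨ (inj₂ (∧-intro (≡⇒≡ᵇ j j refl) h))

    add-cases : ∀ q j k → T (add Q q j k) → T (q k) ⊎ (k ≡ j × T (Q k))
    add-cases q j k h with Equivalence.to (T-∨ {q k}) h
    ... | inj₁ p = inj₁ p
    ... | inj₂ p = inj₂ (≡ᵇ⇒≡ k j (∧-fst p) , ∧-snd {k ≡ᵇ j} p)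

    module _ {cur sel q} (d : Dominates cur sel q)
             {j} (j<n : j < n) (Vj : V j) (later : cur ≤ A j) where
      open Dominates d

      private a = A j

      member-add : ∀ k → T (add Q q j k) → T (Q k) × A k ≤ a
      member-add k h with add-cases q j k h
      ... | inj₁ p = proj₁ (member k p) , ≤-trans (proj₂ (member k p)) later
      ... | inj₂ (refl , p) = p , ≤-refl

      grow : ∀ t → count (early (add Q q j) t) n ≤ bit (B j <ᵇ t) + count (early q t) n
      grow t with B j <ᵇ t in eq
      ... | true = ≤-trans
          (count-union {p = λ k → k ≡ᵇ j} {q = early q t} n (λ k _ h → case k h))
          (+-monoˡ-≤ _ (count≤1 {λ k → k ≡ᵇ j} n
            (λ x y _ _ x≢y p r → x≢y (trans (≡ᵇ⇒≡ x j p) (sym (≡ᵇ⇒≡ y j r))))))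
        where
        case : ∀ k → T (early (add Q q j) t k) → T (k ≡ᵇ j) ⊎ T (early q t k)
        case k h with add-cases q j k (∧-fst h)
        ... | inj₁ p = inj₂ (∧-intro p (∧-snd {add Q q j k} h))
        ... | inj₂ (p , _) = inj₁ (≡⇒≡ᵇ k j p)
      ... | false = count-mono n case
        where
        case : ∀ k → k < n → T (early (add Q q j) t k) → T (early q t k)
        case k _ h with add-cases q j k (∧-fst h)
        ... | inj₁ p = ∧-intro p (∧-snd {add Q q j k} h)
        ... | inj₂ (refl , _) = ⊥-elim (subst T eq (∧-snd {add Q q j k} h))

      -- Members of Q met so far and ending at or after a all contain a.
      crowded : ∀ t → count (early (add Q q j) t) n ≤ 2 + count (early q a) n
      crowded t = ≤-trans
        (count-union {p = λ k → add Q q j k ∧ (a ≤ᵇ B k)} {q = early q a} n case)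
        (+-monoˡ-≤ _ (count≤2 n triple))
        where
        case : ∀ k → k < n → T (early (add Q q j) t k) →
               T (add Q q j k ∧ (a ≤ᵇ B k)) ⊎ T (early q a k)
        case k _ h with a ≤? B k
        ... | yes p = inj₁ (∧-intro (∧-fst h) (≤⇒≤ᵇ p))
        ... | no ¬p with add-cases q j k (∧-fst h)
        ...   | inj₁ p = inj₂ (∧-intro p (<⇒<ᵇ (≰⇒> ¬p)))
        ...   | inj₂ (refl , _) = ⊥-elim (¬p (A≤B Vj))
        covers : ∀ k → T (add Q q j k ∧ (a ≤ᵇ B k)) → T (Q k) × (A k ≤ a × a ≤ B k)
        covers k h = let m = member-add k (∧-fst h) in
          proj₁ m , proj₂ m , ≤ᵇ⇒≤ a (B k) (∧-snd {add Q q j k} h)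
        triple : ∀ x y z → x < n → y < n → z < n → x ≢ y → x ≢ z → y ≢ z →
          T (add Q q j x ∧ (a ≤ᵇ B x)) → T (add Q q j y ∧ (a ≤ᵇ B y)) →
          T (add Q q j z ∧ (a ≤ᵇ B z)) → ⊥
        triple x y z x<n y<n z<n xy xz yz hx hy hz = thin j x y z j<n Vj x<n y<n z<n xy xz yz
          (proj₁ (covers x hx)) (proj₁ (covers y hy)) (proj₁ (covers z hz))
          (proj₂ (covers x hx)) (proj₂ (covers y hy)) (proj₂ (covers z hz))

      -- Used for deadlines after both late ends. There the competitor has at most two arcs more
      -- than it has before `a`, so the invariant is invoked at the deadline `a` instead of `t`, and
      -- `x` and `y`, which end at or after `a`, make up for the two.
      two-late : ∀ {sel′ t} x y → x < n → y < n → x ≢ y → a ≤ B x → a ≤ B y → B x < t → B y < t →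
        sel′ x ≢ 0 → sel′ y ≢ 0 → (∀ k → sel k ≢ 0 → B k < a → sel′ k ≢ 0) →
        count (early (add Q q j) t) n ≤ count (early (chosen sel′) t) n
      two-late {sel′} {t} x y x<n y<n x≢y a≤x a≤y x<t y<t sx sy keep = begin
        count (early (add Q q j) t) n            ≤⟨ crowded t ⟩
        2 + count (early q a) n                  ≤⟨ +-monoʳ-≤ 2 (ahead a) ⟩
        2 + count (early (chosen sel) a) n       ≤⟨ s≤s (count-insert n x x<n
            (λ h → <⇒≱ (<ᵇ⇒< (B x) a (∧-snd {chosen sel x} h)) a≤x)
            (Equivalence.from T-∨ (inj₂ (≡⇒≡ᵇ x x refl)))
            (λ k _ h → Equivalence.from T-∨ (inj₁ h))) ⟩
        1 + count with-x n                       ≤⟨ count-insert n y y<n not-y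
            (∧-intro (≢0⇒nonzero sy) (<⇒<ᵇ y<t)) final ⟩
        count (early (chosen sel′) t) n          ∎
        where
        open ≤-Reasoning
        with-x : ℕ → Bool
        with-x k = early (chosen sel) a k ∨ (k ≡ᵇ x)
        not-y : ¬ T (with-x y)
        not-y h with Equivalence.to (T-∨ {early (chosen sel) a y}) h
        ... | inj₁ p = <⇒≱ (<ᵇ⇒< (B y) a (∧-snd {chosen sel y} p)) a≤y
        ... | inj₂ p = x≢y (sym (≡ᵇ⇒≡ y x p))
        final : ∀ k → k < n → T (with-x k) → T (early (chosen sel′) t k)
        final k _ h with Equivalence.to (T-∨ {early (chosen sel) a k}) h
        ... | inj₁ p = let Bk<a = <ᵇ⇒< (B k) a (∧-snd {chosen sel k} p) in
          ∧-intro (≢0⇒nonzero (keep k (nonzero⇒≢0 (∧-fst p)) Bk<a))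
                  (<⇒<ᵇ (<-trans Bk<a (≤-<-trans a≤x x<t)))
        ... | inj₂ p with ≡ᵇ⇒≡ k x p
        ...   | refl = ∧-intro (≢0⇒nonzero sx) (<⇒<ᵇ x<t)

      -- If the selection gains `j` and loses nothing that ends before `t`, its count rises by the
      -- same `bit (B j <ᵇ t)` that bounds the growth of the competitor.
      one-more : ∀ {sel′ t} → sel j ≡ 0 → sel′ j ≢ 0 → (∀ k → sel k ≢ 0 → B k < t → sel′ k ≢ 0) →
        count (early (add Q q j) t) n ≤ count (early (chosen sel′) t) n
      one-more {sel′} {t} free sj keep = ≤-trans (grow t) (≤-trans (+-monoʳ-≤ _ (ahead t)) gain)
        where
        sub : ∀ k → k < n → T (early (chosen sel) t k) → T (early (chosen sel′) t k)
        sub k _ h = let b = ∧-snd {chosen sel k} h in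
          ∧-intro (≢0⇒nonzero (keep k (nonzero⇒≢0 (∧-fst h)) (<ᵇ⇒< (B k) t b))) b
        gain : bit (B j <ᵇ t) + count (early (chosen sel) t) n ≤ count (early (chosen sel′) t) n
        gain with B j <ᵇ t in eq
        ... | false = count-mono n sub
        ... | true  = count-insert n j j<n
          (λ h → nonzero⇒≢0 (∧-fst h) free)
          (∧-intro (≢0⇒nonzero sj) (Equivalence.from T-≡ eq)) sub

      Dominates-place : ∀ {c} → c ≢ 0 → sel j ≡ 0 → Dominates a (sel [ j ↦ c ]) (add Q q j)
      Dominates-place {c} c≢0 free = record { member = member-add ; met = mt ; ahead = λ t →
          one-more {t = t} free (λ h → c≢0 (trans (sym (update-same sel j c)) h))
            (λ k s _ h → s (trans (sym (update-≢ sel j c k (λ { refl → s free }))) h)) }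
        where
        mt : ∀ k → (sel [ j ↦ c ]) k ≢ 0 → T (Q k) → T (add Q q j k)
        mt k h Qk with update-cases sel j c k
        ... | inj₁ (refl , _) = add-∋ q j Qk
        ... | inj₂ (_ , e)    = add-⊇ q j k (met k (λ z → h (trans e z)) Qk)

    module _ {cur sel i₀ e₀ c₀ i₁ e₁ c₁ q} (v : Inv cur sel i₀ e₀ c₀ i₁ e₁ c₁)
             (d : Dominates cur sel q)
             {j} (j<n : j < n) (Vj : V j) (free : sel j ≡ 0) (later : cur ≤ A j)
             (e₀≤e₁ : e₀ ≤ e₁) (a≤e₀ : A j ≤ e₀) where
      open Dominates d
      open Inv v

      private
        a≤e₁ = ≤-trans a≤e₀ e₀≤e₁
        occ₀ = occupant v j<n Vj free later slot₀ a≤e₀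
        occ₁ = occupant v j<n Vj free later slot₁ a≤e₁
        Bi₀  = proj₂ (proj₂ occ₀)
        Bi₁  = proj₂ (proj₂ occ₁)
        i₀≢i₁ = occupants-≢ v j<n Vj free later a≤e₀ a≤e₁
        i₀≢j  = occupant-≢ v j<n Vj free later slot₀ a≤e₀
        i₀-in : sel i₀ ≢ 0
        i₀-in h = Slot.c≢0 slot₀ (trans (sym (proj₁ (proj₂ occ₀))) h)
        i₁-in : sel i₁ ≢ 0
        i₁-in h = Slot.c≢0 slot₁ (trans (sym (proj₁ (proj₂ occ₁))) h)

      -- Skipping `j` can only hurt at deadlines after `B j`. Both occupants end before such a
      -- deadline, since `j` has the latest end of the three, so `two-late` applies to them.
      Dominates-skip : e₁ ≤ B j → Dominates (A j) sel (add Q q j)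
      Dominates-skip e₁≤b = record
        { member = member-add d j<n Vj later
        ; met    = λ k h Qk → add-⊇ q j k (met k h Qk)
        ; ahead  = ah }
        where
        ah : ∀ t → count (early (add Q q j) t) n ≤ count (early (chosen sel) t) n
        ah t with B j <? t
        ... | yes b<t = two-late d j<n Vj later i₀ i₁ (proj₁ occ₀) (proj₁ occ₁) i₀≢i₁
              (subst (A j ≤_) (sym Bi₀) a≤e₀) (subst (A j ≤_) (sym Bi₁) a≤e₁)
              (subst (_< t) (sym Bi₀) (≤-<-trans (≤-trans e₀≤e₁ e₁≤b) b<t))
              (subst (_< t) (sym Bi₁) (≤-<-trans e₁≤b b<t))
              i₀-in i₁-in (λ k s _ → s)
        ... | no b≮t = ≤-trans (grow d j<n Vj later t)
              (≤-trans (≤-reflexive (cong (_+ count (early q t) n) (bit-false (λ h → b≮t (<ᵇ⇒< (B j) t h)))))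
                       (ahead t))

      -- At a deadline after `e₁`, the survivors `i₀` and `j` both end in time and `two-late`
      -- applies. At an earlier one the dropped arc was not counted, so the exchange is a pure gain.
      Dominates-replace : B j < e₁ → Dominates (A j) ((sel [ i₁ ↦ 0 ]) [ j ↦ c₁ ]) (add Q q j)
      Dominates-replace b<e₁ = record { member = member-add d j<n Vj later ; met = mt ; ahead = ah }
        where
        sel′ : ℕ → ℕ
        sel′ = (sel [ i₁ ↦ 0 ]) [ j ↦ c₁ ]
        j-in : sel′ j ≢ 0
        j-in h = Slot.c≢0 slot₁ (trans (sym (update-same (sel [ i₁ ↦ 0 ]) j c₁)) h)
        kept : ∀ k → sel k ≢ 0 → i₁ ≢ k → sel′ k ≢ 0
        kept k s i₁≢k h = s (trans (sym (trans
          (update-≢ (sel [ i₁ ↦ 0 ]) j c₁ k (λ { refl → s free })) (update-≢ sel i₁ 0 k i₁≢k))) h)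
        mt : ∀ k → sel′ k ≢ 0 → T (Q k) → T (add Q q j k)
        mt k h Qk with update-cases (sel [ i₁ ↦ 0 ]) j c₁ k
        ... | inj₁ (refl , _) = add-∋ q j Qk
        ... | inj₂ (_ , e) with update-cases sel i₁ 0 k
        ...   | inj₁ (_ , f) = ⊥-elim (h (trans e f))
        ...   | inj₂ (_ , f) = add-⊇ q j k (met k (λ z → h (trans e (trans f z))) Qk)
        ah : ∀ t → count (early (add Q q j) t) n ≤ count (early (chosen sel′) t) n
        ah t with e₁ <? t
        ... | yes e₁<t = two-late d j<n Vj later i₀ j (proj₁ occ₀) j<n i₀≢j
              (subst (A j ≤_) (sym Bi₀) a≤e₀) (A≤B Vj)
              (subst (_< t) (sym Bi₀) (≤-<-trans e₀≤e₁ e₁<t)) (<-trans b<e₁ e₁<t)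
              (kept i₀ i₀-in (i₀≢i₁ ∘ sym)) j-in
              (λ k s Bk<a → kept k s (λ { refl → <⇒≱ Bk<a (subst (A j ≤_) (sym Bi₁) a≤e₁) }))
        ... | no e₁≮t = one-more d j<n Vj later free j-in
              (λ k s Bk<t → kept k s (λ { refl → e₁≮t (subst (_< t) Bi₁ Bk<t) }))

-- Cutting the circle

≤ᵇ-true : ∀ {x y} → x ≤ y → (x ≤ᵇ y) ≡ true
≤ᵇ-true h = Equivalence.to T-≡ (≤⇒≤ᵇ h)

≤ᵇ-false : ∀ {x y} → y < x → (x ≤ᵇ y) ≡ false
≤ᵇ-false {x} {y} h with x ≤ᵇ y in eq
... | false = refl
... | true  = ⊥-elim (<⇒≱ h (≤ᵇ⇒≤ x y (Equivalence.from T-≡ eq)))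

module Circle (M : ℕ) (S E : ℕ → ℕ) where

  _onArc_ : ℕ → ℕ → Set
  x onArc k = (S k ≤ E k × S k ≤ x × x ≤ E k) ⊎ (E k < S k × (S k ≤ x ⊎ x ≤ E k))

  unwrapped : ℕ → ℕ
  unwrapped k = if S k ≤ᵇ E k then E k else E k + M

  shift : ℕ → ℕ → ℕ
  shift σ x = if σ ≤ᵇ x then 0 else M

  -- The circle of length M is cut at σ and unrolled to [σ , σ + M); [A k , B k] is the image of
  -- arc k, provided that B k < σ + M, which says that the arc is not severed by the cut.
  A B : ℕ → ℕ → ℕ
  A σ k = S k + shift σ (S k)
  B σ k = unwrapped k + shift σ (S k)

  Unsevered : ℕ → ℕ → Set
  Unsevered σ k = B σ k < σ + M

  lift : ℕ → ℕ → ℕ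
  lift σ x = x + shift σ x

  unwrapped-plain : ∀ {k} → S k ≤ E k → unwrapped k ≡ E k
  unwrapped-plain h rewrite ≤ᵇ-true h = refl

  unwrapped-wrap : ∀ {k} → E k < S k → unwrapped k ≡ E k + M
  unwrapped-wrap h rewrite ≤ᵇ-false h = refl

  shift-0 : ∀ {σ x} → σ ≤ x → shift σ x ≡ 0
  shift-0 h rewrite ≤ᵇ-true h = refl

  shift-M : ∀ {σ x} → x < σ → shift σ x ≡ M
  shift-M h rewrite ≤ᵇ-false h = refl

  lift-0 : ∀ {σ x} → σ ≤ x → lift σ x ≡ x
  lift-0 {σ} {x} h = trans (cong (x +_) (shift-0 h)) (+-identityʳ x)

  lift-M : ∀ {σ x} → x < σ → lift σ x ≡ x + M
  lift-M {σ} {x} h = cong (x +_) (shift-M h)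

  module _ (E<M : ∀ k → E k < M) (S<M : ∀ k → S k < M) where

    S≤unwrapped : ∀ k → S k ≤ unwrapped k
    S≤unwrapped k with S k ≤? E k
    ... | yes h = ≤-trans h (≤-reflexive (sym (unwrapped-plain h)))
    ... | no ¬h = ≤-trans (<⇒≤ (S<M k))
          (≤-trans (m≤n+m M (E k)) (≤-reflexive (sym (unwrapped-wrap (≰⇒> ¬h)))))

    A≤B : ∀ σ k → A σ k ≤ B σ k
    A≤B σ k = +-monoˡ-≤ (shift σ (S k)) (S≤unwrapped k)

    module _ {σ : ℕ} (σ<M : σ < M) where

      private
        ¬x+M<σ : ∀ {x} → ¬ (x + M < σ)
        ¬x+M<σ {x} h = <⇒≱ h (≤-trans (<⇒≤ σ<M) (m≤n+m M x))

        cancel< : ∀ {x y} → x + M < y + M → x < y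
        cancel< {x} {y} = +-cancelʳ-< M x y

        cancel≤ : ∀ {x y} → x + M ≤ y + M → x ≤ y
        cancel≤ {x} {y} = +-cancelʳ-≤ M x y

      -- An arc of the kind `both` starts before the cut and runs past the origin, so it is always
      -- severed: its image ends at or beyond `M + M`, which exceeds `σ + M`.
      data Image (k : ℕ) : Set where
        plain   : σ ≤ S k → S k ≤ E k → A σ k ≡ S k → B σ k ≡ E k → Image k
        wrapped : σ ≤ S k → E k < S k → A σ k ≡ S k → B σ k ≡ E k + M → Image k
        shifted : S k < σ → S k ≤ E k → A σ k ≡ S k + M → B σ k ≡ E k + M → Image k
        both    : S k < σ → E k < S k → B σ k ≡ E k + M + M → Image k

      image : ∀ k → Image k
      image k with σ ≤? S k | S k ≤? E k
      ... | yes p | yes q = plain p q (lift-0 p)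
            (trans (cong₂ _+_ (unwrapped-plain q) (shift-0 p)) (+-identityʳ _))
      ... | yes p | no ¬q = wrapped p (≰⇒> ¬q) (lift-0 p)
            (trans (cong₂ _+_ (unwrapped-wrap (≰⇒> ¬q)) (shift-0 p)) (+-identityʳ _))
      ... | no ¬p | yes q = shifted (≰⇒> ¬p) q (lift-M (≰⇒> ¬p))
            (cong₂ _+_ (unwrapped-plain q) (shift-M (≰⇒> ¬p)))
      ... | no ¬p | no ¬q = both (≰⇒> ¬p) (≰⇒> ¬q)
            (cong₂ _+_ (unwrapped-wrap (≰⇒> ¬q)) (shift-M (≰⇒> ¬p)))

      -- `σ + M` is the next copy of the cut on the unrolled circle, and a severed arc reaches it.
      severed-∋cut : ∀ k → ¬ Unsevered σ k → σ onArc k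
      severed-∋cut k ¬u with image k
      ... | plain p q a b = ⊥-elim (¬u (subst (_< σ + M) (sym b) (<-≤-trans (E<M k) (m≤n+m M σ))))
      ... | wrapped p q a b with σ ≤? E k
      ...   | yes h = inj₂ (q , inj₂ h)
      ...   | no ¬h = ⊥-elim (¬u (subst (_< σ + M) (sym b) (+-monoˡ-< M (≰⇒> ¬h))))
      severed-∋cut k ¬u | shifted p q a b with σ ≤? E k
      ...   | yes h = inj₁ (q , <⇒≤ p , h)
      ...   | no ¬h = ⊥-elim (¬u (subst (_< σ + M) (sym b) (+-monoˡ-< M (≰⇒> ¬h))))
      severed-∋cut k ¬u | both p q b = inj₂ (q , inj₁ (<⇒≤ p))

      start-∋ : ∀ k → S k onArc k
      start-∋ k with S k ≤? E k
      ... | yes h = inj₁ (h , ≤-refl , h)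
      ... | no ¬h = inj₂ (≰⇒> ¬h , inj₁ ≤-refl)

      -- The cut lies just before `σ`, so an arc starting at `σ` begins right after it. Even a
      -- wrapping one stops short of `σ + M`, because `E k < S k`.
      own-unsevered : ∀ k → S k ≡ σ → Unsevered σ k
      own-unsevered k refl with image k
      ... | plain p q a b = subst (_< σ + M) (sym b) (<-≤-trans (E<M k) (m≤n+m M σ))
      ... | wrapped p q a b = subst (_< σ + M) (sym b) (+-monoˡ-< M q)
      ... | shifted p q a b = ⊥-elim (<-irrefl refl p)
      ... | both p q b = ⊥-elim (<-irrefl refl p)

      -- The image of an unsevered arc stays inside the window from `σ` to `σ + M`, where each
      -- coordinate has exactly one lift. Hence membership can be compared there, in this direction
      -- and in the converse `lift⇒onArc`.
      onArc⇒lift : ∀ {x k} → x < M → Unsevered σ k → x onArc k → A σ k ≤ lift σ x × lift σ x ≤ B σ k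
      onArc⇒lift {x} {k} x<M u h with image k | σ ≤? x
      ... | both p q b | _ = ⊥-elim (¬x+M<σ (cancel< (subst (_< σ + M) b u)))
      ... | plain p q a b | yes σ≤x rewrite lift-0 σ≤x | a | b with h
      ...   | inj₁ (_ , l , r) = l , r
      ...   | inj₂ (w , _) = ⊥-elim (<⇒≱ w q)
      onArc⇒lift {x} {k} x<M u h | plain p q a b | no ¬σ≤x with h
      ...   | inj₁ (_ , l , _) = ⊥-elim (¬σ≤x (≤-trans p l))
      ...   | inj₂ (w , _) = ⊥-elim (<⇒≱ w q)
      onArc⇒lift {x} {k} x<M u h | wrapped p q a b | yes σ≤x rewrite lift-0 σ≤x | a | b with h
      ...   | inj₁ (w , _) = ⊥-elim (<⇒≱ q w)
      ...   | inj₂ (_ , inj₁ l) = l , ≤-trans (<⇒≤ x<M) (m≤n+m M (E k))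
      ...   | inj₂ (_ , inj₂ r) = ⊥-elim (<⇒≱ (cancel< u) (≤-trans σ≤x r))
      onArc⇒lift {x} {k} x<M u h | wrapped p q a b | no ¬σ≤x rewrite lift-M (≰⇒> ¬σ≤x) | a | b with h
      ...   | inj₁ (w , _) = ⊥-elim (<⇒≱ q w)
      ...   | inj₂ (_ , inj₁ l) = ⊥-elim (¬σ≤x (≤-trans p l))
      ...   | inj₂ (_ , inj₂ r) = ≤-trans (<⇒≤ (S<M k)) (m≤n+m M x) , +-monoˡ-≤ M r
      onArc⇒lift {x} {k} x<M u h | shifted p q a b | yes σ≤x rewrite b with h
      ...   | inj₁ (_ , _ , r) = ⊥-elim (<⇒≱ (cancel< u) (≤-trans σ≤x r))
      ...   | inj₂ (w , _) = ⊥-elim (<⇒≱ w q)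
      onArc⇒lift {x} {k} x<M u h | shifted p q a b | no ¬σ≤x rewrite lift-M (≰⇒> ¬σ≤x) | a | b with h
      ...   | inj₁ (_ , l , r) = +-monoˡ-≤ M l , +-monoˡ-≤ M r
      ...   | inj₂ (w , _) = ⊥-elim (<⇒≱ w q)

      lift⇒onArc : ∀ {x k} → x < M → Unsevered σ k → A σ k ≤ lift σ x → lift σ x ≤ B σ k → x onArc k
      lift⇒onArc {x} {k} x<M u l r with image k | σ ≤? x
      ... | both p q b | _ = ⊥-elim (¬x+M<σ (cancel< (subst (_< σ + M) b u)))
      ... | plain p q a b | yes σ≤x rewrite lift-0 σ≤x | a | b = inj₁ (q , l , r)
      ... | plain p q a b | no ¬σ≤x rewrite lift-M (≰⇒> ¬σ≤x) | a | b =
            ⊥-elim (<⇒≱ (E<M k) (≤-trans (m≤n+m M x) r))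
      ... | wrapped p q a b | yes σ≤x rewrite lift-0 σ≤x | a | b = inj₂ (q , inj₁ l)
      ... | wrapped p q a b | no ¬σ≤x rewrite lift-M (≰⇒> ¬σ≤x) | a | b = inj₂ (q , inj₂ (cancel≤ r))
      ... | shifted p q a b | yes σ≤x rewrite lift-0 σ≤x | a | b =
            ⊥-elim (<⇒≱ x<M (≤-trans (m≤n+m M (S k)) l))
      ... | shifted p q a b | no ¬σ≤x rewrite lift-M (≰⇒> ¬σ≤x) | a | b =
            inj₁ (q , cancel≤ l , cancel≤ r)

      meet⇒overlap : ∀ {j k} → Unsevered σ j → Unsevered σ k → S j onArc k ⊎ S k onArc j →
        A σ j ≤ B σ k × A σ k ≤ B σ j
      meet⇒overlap {j} {k} uj uk (inj₁ h) with onArc⇒lift (S<M j) uk h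
      ... | l , r = r , ≤-trans l (A≤B σ j)
      meet⇒overlap {j} {k} uj uk (inj₂ h) with onArc⇒lift (S<M k) uj h
      ... | l , r = ≤-trans l (A≤B σ k) , r

      -- o = 0 and o = M are the two passes over the arcs sorted by S.
      pass : ∀ {o k} → o ≡ 0 ⊎ o ≡ M → σ < S k + o → unwrapped k + o < σ + M → o ≡ shift σ (S k)
      pass {k = k} (inj₁ refl) p q = sym (shift-0 (<⇒≤ (subst (σ <_) (+-identityʳ (S k)) p)))
      pass {k = k} (inj₂ refl) p q =
        sym (shift-M (≤-<-trans (S≤unwrapped k) (cancel< q)))

      beyond-cut : ∀ k → S k ≢ σ → σ < A σ k
      beyond-cut k ne with σ ≤? S k
      ... | yes h = subst (σ <_) (sym (lift-0 h)) (≤∧≢⇒< h (ne ∘ sym))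
      ... | no ¬h = subst (σ <_) (sym (lift-M (≰⇒> ¬h))) (<-≤-trans σ<M (m≤n+m M (S k)))

      shift-cases : ∀ k → shift σ (S k) ≡ 0 ⊎ shift σ (S k) ≡ M
      shift-cases k with σ ≤? S k
      ... | yes h = inj₁ (shift-0 h)
      ... | no ¬h = inj₂ (shift-M (≰⇒> ¬h))

-- The algorithm

-- Register 0 holds n and register 1 the length M of the circle.  Array 0 is the best selection
-- found so far and register 19 its size; arrays 1 and 2 hold the ranks of the start points and of
-- the unwrapped end points; array 3 lists the arcs by start; array 4 is the selection for the
-- current cut, whose entries are the colours 1 and 2, or 0 for arcs left out.

increment : ℕ → Prog
increment x = set x (con 1 ⊕ reg x)

-- Counts the endpoints strictly below p, which are the y for which p ≤ y fails.
rankOf : Endpoint → ℕ → Prog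
rankOf p x =
  set (4 + x) (con 0) ⨟
  for 3 0
    ( cond (p ≤ᵖ startOf (reg 3)) nop (increment (4 + x))
    ⨟ cond (p ≤ᵖ endOf (reg 3)) nop (increment (4 + x)))

rank-store rankAll : Prog
rank-store =
  put 1 (reg 2) (reg 4) ⨟
  cond (reg 4 ≤ⁿ reg 5) nop (set 5 (reg 5 ⊕ reg 1)) ⨟
  put 2 (reg 2) (reg 5)
rankAll = for 2 0 (rankOf (startOf (reg 2)) 0 ⨟ rankOf (endOf (reg 2)) 1 ⨟ rank-store)

-- A bucket sort: for each rank below `M`, all arcs are scanned for that start. Tests offer only ≤,
-- so equality takes two nested comparisons.
sort-inner sortStarts : Prog
sort-inner = cond (arr 1 (reg 3) ≤ⁿ reg 2)
  (cond (reg 2 ≤ⁿ arr 1 (reg 3)) (put 3 (reg 6) (reg 3) ⨟ increment 6) nop) nop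
sortStarts = set 6 (con 0) ⨟ for 2 1 (for 3 0 sort-inner)

-- The two colour classes are kept in slots (12, 13, 14) and (15, 16, 17): the last arc of the
-- class, its end, and the colour.  The arc under consideration is register 9, with start 10 and
-- end 11; it is placed in a slot whose last arc has ended, and otherwise the arc with the latest
-- end among the three is dropped.  Register 7 is the shift applied in the current pass.
place replace compete insert exchange order visit : Prog
place    = put 4 (reg 9) (reg 14) ⨟ set 12 (reg 9) ⨟ set 13 (reg 11)
replace  = put 4 (reg 15) (con 0) ⨟ put 4 (reg 9) (reg 17) ⨟ set 15 (reg 9) ⨟ set 16 (reg 11)
compete  = cond (reg 16 ≤ⁿ reg 11) nop replace
insert   = cond (con 1 ⊕ reg 13 ≤ⁿ reg 10) place compete
exchange =
  set 20 (reg 12) ⨟ set 21 (reg 13) ⨟ set 22 (reg 14) ⨟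
  set 12 (reg 15) ⨟ set 13 (reg 16) ⨟ set 14 (reg 17) ⨟
  set 15 (reg 20) ⨟ set 16 (reg 21) ⨟ set 17 (reg 22)
order = cond (reg 13 ≤ⁿ reg 16) nop exchange
visit =
  set 9 (arr 3 (reg 3)) ⨟
  set 10 (arr 1 (reg 9) ⊕ reg 7) ⨟
  set 11 (arr 2 (reg 9) ⊕ reg 7) ⨟
  -- These two tests keep the arcs whose image under the current shift starts strictly after the cut
  -- and ends before its next copy. Strictness also rejects every other arc that starts exactly at
  -- the cut.
  cond (reg 10 ≤ⁿ reg 8) nop
    (cond (reg 8 ⊕ reg 1 ≤ⁿ reg 11) nop
      (cond (con 1 ≤ⁿ arr 4 (reg 9)) nop (order ⨟ insert)))

-- seed selects the arc w in register 2, whose start (register 8) is the cut.  The second slot is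
-- still empty; the end point given to it lies before the start of every arc to come.
clear seed passes tally copy save cutAt main : Prog
clear = for 3 0 (put 4 (reg 3) (con 0))
seed =
  set 8 (arr 1 (reg 2)) ⨟ put 4 (reg 2) (con 1) ⨟
  set 12 (reg 2) ⨟ set 13 (arr 2 (reg 2)) ⨟ set 14 (con 1) ⨟
  set 15 (reg 2) ⨟ set 16 (reg 8) ⨟ set 17 (con 2)
passes = set 7 (con 0) ⨟ for 3 0 visit ⨟ set 7 (reg 1) ⨟ for 3 0 visit
tally = set 18 (con 0) ⨟ for 3 0 (cond (con 1 ≤ⁿ arr 4 (reg 3)) (increment 18) nop)
copy = for 3 0 (put 0 (reg 3) (arr 4 (reg 3)))
save = cond (reg 18 ≤ⁿ reg 19) nop (set 19 (reg 18) ⨟ copy)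
cutAt = (clear ⨟ seed ⨟ passes) ⨟ tally ⨟ save
main = rankAll ⨟ sortStarts ⨟ for 2 0 cutAt

program : Program
program = 1 ≔ con 1 ⊕ (reg 0 ⊕ reg 0) ⨾ compile main

-- Correctness of the sweeps

module Cuts {c ℓ₁ ℓ₂} (O : DecTotalOrder c ℓ₁ ℓ₂) {n} (arcs : Fin n → Arc O)
  (M : ℕ) (S E : ℕ → ℕ) (E<M : ∀ k → E k < M) (S<M : ∀ k → S k < M) where

  open Semantics O arcs
  open Circle M S E

  -- Both are identities.  Agda decides that the states agree cheaply only while the programs are
  -- variables: on concrete programs it unfolds exec, and the states grow exponentially.
  exec-three : ∀ {ℓ} (R : State → Set ℓ) P₁ P₂ P₃ σ →
    R (exec P₃ (exec P₂ (exec P₁ σ))) → R (exec (P₁ ⨟ P₂ ⨟ P₃) σ)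
  exec-three R P₁ P₂ P₃ σ h = h

  exec-resp : ∀ {ℓ} (R : State → Set ℓ) P P′ σ → P ≡ P′ → R (exec P σ) → R (exec P′ σ)
  exec-resp R P P′ σ refl h = h

  Meet : ℕ → ℕ → Set
  Meet j k = S j onArc k ⊎ S k onArc j

  record Listing (L : ℕ → ℕ) : Set where
    field
      within : ∀ x → x < n → L x < n
      sorted : ∀ x y → x ≤ y → y < n → S (L x) ≤ S (L y)
      covers : ∀ j → j < n → ∃ λ x → x < n × L x ≡ j

  record Tables (L : ℕ → ℕ) (τ : State) : Set where
    field
      reg-n : regs τ 0 ≡ n
      reg-M : regs τ 1 ≡ M
      arr-S : ∀ i → i < n → arrs τ 1 i ≡ S i
      arr-U : ∀ i → i < n → arrs τ 2 i ≡ unwrapped i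
      arr-L : ∀ i → arrs τ 3 i ≡ L i

  Tables-frame : ∀ {L τ υ} → regs υ 0 ≡ regs τ 0 → regs υ 1 ≡ regs τ 1 → arrs υ 1 ≡ arrs τ 1 →
    arrs υ 2 ≡ arrs τ 2 → arrs υ 3 ≡ arrs τ 3 → Tables L τ → Tables L υ
  Tables-frame r₀ r₁ a₁ a₂ a₃ t = record
    { reg-n = trans r₀ reg-n
    ; reg-M = trans r₁ reg-M
    ; arr-S = λ i i<n → trans (cong (λ f → f i) a₁) (arr-S i i<n)
    ; arr-U = λ i i<n → trans (cong (λ f → f i) a₂) (arr-U i i<n)
    ; arr-L = λ i → trans (cong (λ f → f i) a₃) (arr-L i) }
    where open Tables t

  module AtCut (w : ℕ) where

    σᶜ : ℕ
    σᶜ = S w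

    open Greedy n (A σᶜ) (B σᶜ) (Unsevered σᶜ) (λ {k} _ → A≤B E<M S<M σᶜ k) public

    Thin : (ℕ → Bool) → Set
    Thin Q = ∀ x i j k → x < n → Unsevered σᶜ x → i < n → j < n → k < n →
      i ≢ j → i ≢ k → j ≢ k → T (Q i) → T (Q j) → T (Q k) →
      A σᶜ i ≤ A σᶜ x × A σᶜ x ≤ B σᶜ i → A σᶜ j ≤ A σᶜ x × A σᶜ x ≤ B σᶜ j →
      A σᶜ k ≤ A σᶜ x × A σᶜ x ≤ B σᶜ k → ⊥

    State-Inv : ℕ → State → Set
    State-Inv cur τ = Inv cur (arrs τ 4) (regs τ 12) (regs τ 13) (regs τ 14)
                                         (regs τ 15) (regs τ 16) (regs τ 17)

    -- Quantifying over `Q` here lets a single execution be compared with all competitors at once.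
    -- `W` will say that arc `j` falls into the window of the current pass, in which case it must
    -- count as met.
    Preserves : ℕ → (ℕ → ℕ) → ℕ → (ℕ → ℕ) → ℕ → Set → Set
    Preserves cur sel cur′ sel′ j W = ∀ Q (thin : Thin Q) q → Dominates Q thin cur sel q →
      ∃ λ q′ → Dominates Q thin cur′ sel′ q′ × (∀ x → T (q x) → T (q′ x)) ×
               (W → T (Q j) → T (q′ j))

    Outcome : ℕ → (ℕ → ℕ) → ℕ → Set → State → Set
    Outcome cur sel j W τ = ∃ λ cur′ →
      (cur′ ≡ cur ⊎ (cur′ ≡ A σᶜ j × W)) × State-Inv cur′ τ ×
      Preserves cur sel cur′ (arrs τ 4) j W

    module _ {cur : ℕ} {W : Set} (window : W) where

      place-outcome : ∀ τ → State-Inv cur τ → regs τ 9 < n → Unsevered σᶜ (regs τ 9) →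
        regs τ 11 ≡ B σᶜ (regs τ 9) → arrs τ 4 (regs τ 9) ≡ 0 → cur ≤ A σᶜ (regs τ 9) →
        regs τ 13 < A σᶜ (regs τ 9) →
        Outcome cur (arrs τ 4) (regs τ 9) W (exec place τ)
      place-outcome τ v j<n Vj b≡ free later e₀<a =
        A σᶜ (regs τ 9) , inj₂ (refl , window) ,
        subst (λ b → Inv (A σᶜ (regs τ 9)) (arrs τ 4 [ regs τ 9 ↦ regs τ 14 ])
                         (regs τ 9) b (regs τ 14) (regs τ 15) (regs τ 16) (regs τ 17))
              (sym b≡) (Inv-place v j<n Vj free later e₀<a) ,
        λ Q thin q d → add Q q (regs τ 9) ,
          Dominates-place Q thin d j<n Vj later (Slot.c≢0 (Inv.slot₀ v)) free ,
          add-⊇ Q thin q (regs τ 9) , λ _ → add-∋ Q thin q (regs τ 9)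

      compete-outcome : ∀ τ → State-Inv cur τ → regs τ 9 < n → Unsevered σᶜ (regs τ 9) →
        regs τ 11 ≡ B σᶜ (regs τ 9) → arrs τ 4 (regs τ 9) ≡ 0 → cur ≤ A σᶜ (regs τ 9) →
        regs τ 13 ≤ regs τ 16 → A σᶜ (regs τ 9) ≤ regs τ 13 →
        Outcome cur (arrs τ 4) (regs τ 9) W (exec compete τ)
      compete-outcome τ v j<n Vj b≡ free later e₀≤e₁ a≤e₀ =
        cond-≤ (Outcome cur (arrs τ 4) (regs τ 9) W) (reg 16) (reg 11) nop replace τ
          (λ e₁≤b → A σᶜ (regs τ 9) , inj₂ (refl , window) , Inv-later later v ,
            λ Q thin q d → add Q q (regs τ 9) ,
              Dominates-skip Q thin v d j<n Vj free later e₀≤e₁ a≤e₀ (subst (regs τ 16 ≤_) b≡ e₁≤b) ,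
              add-⊇ Q thin q (regs τ 9) , λ _ → add-∋ Q thin q (regs τ 9))
          (λ b<e₁ → A σᶜ (regs τ 9) , inj₂ (refl , window) ,
            subst (λ b → Inv (A σᶜ (regs τ 9)) ((arrs τ 4 [ regs τ 15 ↦ 0 ]) [ regs τ 9 ↦ regs τ 17 ])
                             (regs τ 12) (regs τ 13) (regs τ 14) (regs τ 9) b (regs τ 17))
                  (sym b≡) (Inv-replace v j<n Vj free later (≤-trans a≤e₀ e₀≤e₁)) ,
            λ Q thin q d → add Q q (regs τ 9) ,
              Dominates-replace Q thin v d j<n Vj free later e₀≤e₁ a≤e₀ (subst (_< regs τ 16) b≡ b<e₁) ,
              add-⊇ Q thin q (regs τ 9) , λ _ → add-∋ Q thin q (regs τ 9))

      insert-outcome : ∀ τ → State-Inv cur τ → regs τ 9 < n → Unsevered σᶜ (regs τ 9) →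
        regs τ 10 ≡ A σᶜ (regs τ 9) → regs τ 11 ≡ B σᶜ (regs τ 9) →
        arrs τ 4 (regs τ 9) ≡ 0 → cur ≤ A σᶜ (regs τ 9) → regs τ 13 ≤ regs τ 16 →
        Outcome cur (arrs τ 4) (regs τ 9) W (exec insert τ)
      insert-outcome τ v j<n Vj a≡ b≡ free later e₀≤e₁ =
        cond-≤ (Outcome cur (arrs τ 4) (regs τ 9) W) (con 1 ⊕ reg 13) (reg 10) place compete τ
          (λ e₀<a → place-outcome τ v j<n Vj b≡ free later (subst (regs τ 13 <_) a≡ e₀<a))
          (λ a≤e₀ → compete-outcome τ v j<n Vj b≡ free later e₀≤e₁
                      (subst (_≤ regs τ 13) a≡ (s≤s⁻¹ a≤e₀)))

      order-outcome : ∀ τ → State-Inv cur τ → regs τ 9 < n → Unsevered σᶜ (regs τ 9) →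
        regs τ 10 ≡ A σᶜ (regs τ 9) → regs τ 11 ≡ B σᶜ (regs τ 9) →
        arrs τ 4 (regs τ 9) ≡ 0 → cur ≤ A σᶜ (regs τ 9) →
        Outcome cur (arrs τ 4) (regs τ 9) W (exec (order ⨟ insert) τ)
      order-outcome τ v j<n Vj a≡ b≡ free later =
        cond-≤ (λ υ → Outcome cur (arrs τ 4) (regs τ 9) W (exec insert υ)) (reg 13) (reg 16) nop exchange τ
          (insert-outcome τ v j<n Vj a≡ b≡ free later)
          (λ e₁<e₀ → insert-outcome (exec exchange τ) (Inv-swap v) j<n Vj a≡ b≡ free later (<⇒≤ e₁<e₀))

    Window : ℕ → ℕ → Set
    Window o j = σᶜ < S j + o × unwrapped j + o < σᶜ + M

    visit-outcome : ∀ {cur} o (L : ℕ → ℕ) τ → (∀ i → i < n → arrs τ 1 i ≡ S i) →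
      (∀ i → i < n → arrs τ 2 i ≡ unwrapped i) → (∀ i → arrs τ 3 i ≡ L i) →
      regs τ 1 ≡ M → regs τ 7 ≡ o → regs τ 8 ≡ σᶜ → o ≡ 0 ⊎ o ≡ M →
      State-Inv cur τ → L (regs τ 3) < n →
      (Window o (L (regs τ 3)) → cur ≤ S (L (regs τ 3)) + o) →
      Outcome cur (arrs τ 4) (L (regs τ 3)) (Window o (L (regs τ 3))) (exec visit τ)
    visit-outcome {cur} o L τ arr-S arr-U arr-L reg-M reg-o reg-σ o-case v j<n later =
      subst (λ x → Outcome cur (arrs τ 4) x W (exec visit τ)) (arr-L k)
        (cond-≤ R (reg 10) (reg 8) nop rest₁ τ′ (λ a≤σ → outside (λ ω →
             <⇒≱ (proj₁ ω) (≤-trans (≤-reflexive (sym a≡)) (≤-trans a≤σ (≤-reflexive reg-σ)))))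
          (λ σ<a → cond-≤ R (reg 8 ⊕ reg 1) (reg 11) nop rest₂ τ′
            (λ σ+M≤b → outside (λ ω → <⇒≱ (proj₂ ω)
               (≤-trans (≤-reflexive (cong₂ _+_ (sym reg-σ) (sym reg-M)))
                 (≤-trans σ+M≤b (≤-reflexive b≡)))))
            (λ b<σ+M → inside
              (subst₂ _<_ reg-σ a≡ σ<a , subst₂ _<_ b≡ (cong₂ _+_ reg-σ reg-M) b<σ+M))))
      where
      k = regs τ 3
      j = arrs τ 3 k
      W = Window o (L k)
      j≡ : j ≡ L k
      j≡ = arr-L k
      τ′ = exec (set 9 (arr 3 (reg 3)) ⨟
                 set 10 (arr 1 (reg 9) ⊕ reg 7) ⨟ set 11 (arr 2 (reg 9) ⊕ reg 7)) τ
      R = Outcome cur (arrs τ 4) j W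
      rest₂ = cond (con 1 ≤ⁿ arr 4 (reg 9)) nop (order ⨟ insert)
      rest₁ = cond (reg 8 ⊕ reg 1 ≤ⁿ reg 11) nop rest₂
      j<n′ : j < n
      j<n′ = subst (_< n) (sym j≡) j<n
      a≡ : arrs τ 1 j + regs τ 7 ≡ S (L k) + o
      a≡ = cong₂ _+_ (trans (arr-S j j<n′) (cong S j≡)) reg-o
      b≡ : arrs τ 2 j + regs τ 7 ≡ unwrapped (L k) + o
      b≡ = cong₂ _+_ (trans (arr-U j j<n′) (cong unwrapped j≡)) reg-o
      outside : ¬ W → R τ′
      outside ¬ω = cur , inj₁ refl , v ,
        λ Q thin q d → q , d , (λ x h → h) , λ ω → ⊥-elim (¬ω ω)
      inside : W → R (exec rest₂ τ′)
      inside ω = cond-≤ R (con 1) (arr 4 (reg 9)) nop (order ⨟ insert) τ′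
        -- The state does not change for an arc that is already selected, and `met` shows that `q`
        -- contains it if `Q` does. The other branch obtains from the same test the hypothesis that
        -- `j` is free.
        (λ chosen-j → cur , inj₁ refl , v , λ Q thin q d → q , d , (λ x h → h) ,
          λ _ Qj → Dominates.met d j (λ z → <⇒≱ chosen-j (≤-reflexive z)) Qj)
        (λ free → order-outcome ω τ′ v j<n′
          (subst (Unsevered σᶜ) (sym j≡) (subst (λ x → unwrapped (L k) + x < σᶜ + M) o≡ (proj₂ ω)))
          (trans a≡ (trans (cong (S (L k) +_) o≡) (cong (A σᶜ) (sym j≡))))
          (trans b≡ (trans (cong (unwrapped (L k) +_) o≡) (cong (B σᶜ) (sym j≡))))
          (n≤0⇒n≡0 (s≤s⁻¹ free))
          (≤-trans (later ω) (≤-reflexive (trans (cong (S (L k) +_) o≡) (cong (A σᶜ) (sym j≡))))))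
        where
        o≡ : o ≡ shift σᶜ (S (L k))
        o≡ = pass E<M S<M (S<M w) {k = L k} o-case (proj₁ ω) (proj₂ ω)

    -- D holds of the arcs dealt with before the pass; k counts the arcs visited in it.
    record PassInv (D : ℕ → Set) (o : ℕ) (L : ℕ → ℕ) (k : ℕ) (τ : State) : Set where
      field
        cur     : ℕ
        inv     : State-Inv cur τ
        cur≤    : cur ≤ M + o
        upcoming : ∀ x → k ≤ x → x < n → Window o (L x) → cur ≤ S (L x) + o
        optimal : ∀ Q (thin : Thin Q) → T (Q w) → ∃ λ q → Dominates Q thin cur (arrs τ 4) q ×
          (∀ j → D j ⊎ (∃ λ x → x < k × L x ≡ j × Window o j) → T (Q j) → T (q j))

    pass-step : ∀ {D o L} k τ → Tables L τ → Listing L → k < n → regs τ 3 ≡ k →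
      regs τ 7 ≡ o → regs τ 8 ≡ σᶜ → o ≡ 0 ⊎ o ≡ M →
      PassInv D o L k τ → PassInv D o L (suc k) (exec visit τ)
    pass-step {D} {o} {L} k τ t li k<n refl reg-o reg-σ o-case p with
      visit-outcome o L τ (Tables.arr-S t) (Tables.arr-U t) (Tables.arr-L t) (Tables.reg-M t)
        reg-o reg-σ o-case (PassInv.inv p) (Listing.within li k k<n) (PassInv.upcoming p k ≤-refl k<n)
    ... | cur′ , cur-case , inv′ , preserves = record
      { cur = cur′ ; inv = inv′ ; cur≤ = bounded cur-case ; upcoming = next cur-case ; optimal = opt }
      where
      open PassInv p
      at : ∀ {x} → x ≡ A σᶜ (L k) × Window o (L k) → x ≡ S (L k) + o
      at (e , ω) = trans e (cong (S (L k) +_)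
        (sym (pass E<M S<M (S<M w) {k = L k} o-case (proj₁ ω) (proj₂ ω))))
      bounded : cur′ ≡ cur ⊎ (cur′ ≡ A σᶜ (L k) × Window o (L k)) → cur′ ≤ M + o
      bounded (inj₁ refl) = cur≤
      bounded (inj₂ h) = ≤-trans (≤-reflexive (at h)) (+-monoˡ-≤ o (<⇒≤ (S<M (L k))))
      next : cur′ ≡ cur ⊎ (cur′ ≡ A σᶜ (L k) × Window o (L k)) →
             ∀ x → suc k ≤ x → x < n → Window o (L x) → cur′ ≤ S (L x) + o
      next (inj₁ refl) x k<x x<n ω = upcoming x (<⇒≤ k<x) x<n ω
      next (inj₂ h) x k<x x<n ω = ≤-trans (≤-reflexive (at h))
        (+-monoˡ-≤ o (Listing.sorted li k x (<⇒≤ k<x) x<n))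
      opt : ∀ Q (thin : Thin Q) → T (Q w) →
            ∃ λ q → Dominates Q thin cur′ (arrs (exec visit τ) 4) q ×
            (∀ j → D j ⊎ (∃ λ x → x < suc k × L x ≡ j × Window o j) → T (Q j) → T (q j))
      opt Q thin Qw with optimal Q thin Qw
      ... | q , d , met with preserves Q thin q d
      ...   | q′ , d′ , q⊆q′ , new = q′ , d′ , met′
        where
        met′ : ∀ j → D j ⊎ (∃ λ x → x < suc k × L x ≡ j × Window o j) → T (Q j) → T (q′ j)
        met′ j (inj₁ h) Qj = q⊆q′ j (met j (inj₁ h) Qj)
        met′ j (inj₂ (x , x<1+k , refl , ω)) Qj with m≤n⇒m<n∨m≡n (s≤s⁻¹ x<1+k)
        ... | inj₁ x<k  = q⊆q′ j (met j (inj₂ (x , x<k , refl , ω)) Qj)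
        ... | inj₂ refl = new ω Qj

    pass-spec : ∀ {D o L} σ → Tables L σ → Listing L → regs σ 7 ≡ o → regs σ 8 ≡ σᶜ →
      o ≡ 0 ⊎ o ≡ M → PassInv D o L 0 σ → PassInv D o L n (exec (for 3 0 visit) σ)
    pass-spec {D} {o} {L} σ t li reg-o reg-σ o-case base =
      subst (λ k → PassInv D o L k (exec (for 3 0 visit) σ)) (Tables.reg-n t)
        (for-invariant 3 0 visit σ (PassInv D o L) tt (relabel base)
          (λ k τ k<N reg-k frʳ frᵃ p → relabel
            (pass-step k τ (Tables-frame (frʳ 0 tt) (frʳ 1 tt) (frᵃ 1 tt) (frᵃ 2 tt) (frᵃ 3 tt) t)
              li (subst (k <_) (Tables.reg-n t) k<N) reg-k
              (trans (frʳ 7 tt) reg-o) (trans (frʳ 8 tt) reg-σ) o-case p)))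
      where
      relabel : ∀ {k τ x} → PassInv D o L k τ → PassInv D o L k (store 3 x τ)
      relabel p = record { cur = cur ; inv = inv ; cur≤ = cur≤ ; upcoming = upcoming ; optimal = optimal }
        where open PassInv p

  -- Search over all cuts

  size : (ℕ → ℕ) → ℕ
  size sel = count (λ k → nonzero (sel k)) n

  Feasible : (ℕ → ℕ) → Set
  Feasible sel = (∀ k → k < n → sel k ≤ 2) ×
    (∀ j k → j < n → k < n → j ≢ k → sel j ≡ sel k → sel j ≢ 0 → ¬ Meet j k)

  -- The competitors beaten by the sweep for `w`. Other arcs starting at the cut are excluded
  -- because they contain the start of `w`, just as severed arcs do; `lose-one` charges both kinds
  -- to the same single loss.
  Candidate : ℕ → (ℕ → Bool) → Set
  Candidate w Q = AtCut.Thin w Q × T (Q w) ×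
    (∀ j → j < n → T (Q j) → Unsevered (S w) j × (j ≡ w ⊎ S j ≢ S w))

  -- The loop erases indices below `n` only. That array 4 has no other nonzero entries is what makes
  -- it zero everywhere, as the initial invariant of the sweep demands.
  clear-spec : ∀ τ → regs τ 0 ≡ n → (∀ k → arrs τ 4 k ≢ 0 → k < n) →
    ∀ k → arrs (exec clear τ) 4 k ≡ 0
  clear-spec τ reg-n blank k with arrs (exec clear τ) 4 k ≟ 0
  ... | yes e = e
  ... | no ¬e = ⊥-elim (¬e (proj₁ cleared k (subst (k <_) (sym reg-n) (proj₂ cleared k ¬e))))
    where
    I : ℕ → State → Set
    I m υ = (∀ i → i < m → arrs υ 4 i ≡ 0) × (∀ i → arrs υ 4 i ≢ 0 → i < n)
    step : ∀ m υ → regs υ 3 ≡ m → I m υ → I (suc m) (exec (put 4 (reg 3) (con 0)) υ)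
    step m υ refl (zeros , within) = zeros′ , within′
      where
      zeros′ : ∀ i → i < suc m → (arrs υ 4 [ m ↦ 0 ]) i ≡ 0
      zeros′ i i<1+m with m ≟ i
      ... | yes refl = update-same (arrs υ 4) i 0
      ... | no m≢i   = trans (update-≢ (arrs υ 4) m 0 i m≢i)
                         (zeros i (≤∧≢⇒< (s≤s⁻¹ i<1+m) (m≢i ∘ sym)))
      within′ : ∀ i → (arrs υ 4 [ m ↦ 0 ]) i ≢ 0 → i < n
      within′ i h with m ≟ i
      ... | yes refl = ⊥-elim (h (update-same (arrs υ 4) i 0))
      ... | no m≢i   = within i (λ e → h (trans (update-≢ (arrs υ 4) m 0 i m≢i) e))
    cleared : I (regs τ 0) (exec clear τ)
    cleared = for-invariant 3 0 (put 4 (reg 3) (con 0)) τ I tt ((λ _ ()) , blank)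
      (λ m υ _ e _ _ → step m υ e)

  tally-spec : ∀ τ → regs τ 0 ≡ n → regs (exec tally τ) 18 ≡ size (arrs τ 4)
  tally-spec τ reg-n = subst (λ m → regs (exec tally τ) 18 ≡ count p m) reg-n
    (for-invariant 3 0 body (store 18 0 τ) (λ m υ → regs υ 18 ≡ count p m) tt refl step)
    where
    p : ℕ → Bool
    p k = nonzero (arrs τ 4 k)
    body : Prog
    body = cond (con 1 ≤ⁿ arr 4 (reg 3)) (increment 18) nop
    step : ∀ m υ → m < regs τ 0 → regs υ 3 ≡ m →
      (∀ x → T (keepsReg x (for 3 0 body)) → regs υ x ≡ regs (store 18 0 τ) x) →
      (∀ a → T (keepsArr a body) → arrs υ a ≡ arrs τ a) →
      regs υ 18 ≡ count p m → regs (exec body υ) 18 ≡ count p (suc m)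
    step m υ _ refl _ frᵃ e = cond-≤ (λ χ → regs χ 18 ≡ count p (suc m))
      (con 1) (arr 4 (reg 3)) (increment 18) nop υ
      (λ h → cong₂ _+_ (sym (bit-true {p m} (≢0⇒nonzero (λ z → <⇒≱ h (≤-reflexive (trans same z)))))) e)
      (λ h → cong₂ _+_ (sym (bit-false {p m} (λ z → nonzero⇒≢0 z (trans (sym same) (n≤0⇒n≡0 (s≤s⁻¹ h)))))) e)
      where
      same : arrs υ 4 m ≡ arrs τ 4 m
      same = cong (λ f → f m) (frᵃ 4 tt)

  copy-spec : ∀ τ → regs τ 0 ≡ n → ∀ i → i < n → arrs (exec copy τ) 0 i ≡ arrs τ 4 i
  copy-spec τ reg-n i i<n =
    for-invariant 3 0 body τ (λ m υ → ∀ i → i < m → arrs υ 0 i ≡ arrs τ 4 i) tt (λ _ ()) step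
      i (subst (i <_) (sym reg-n) i<n)
    where
    body : Prog
    body = put 0 (reg 3) (arr 4 (reg 3))
    step : ∀ m υ → m < regs τ 0 → regs υ 3 ≡ m →
      (∀ x → T (keepsReg x (for 3 0 body)) → regs υ x ≡ regs τ x) →
      (∀ a → T (keepsArr a body) → arrs υ a ≡ arrs τ a) →
      (∀ i → i < m → arrs υ 0 i ≡ arrs τ 4 i) →
      ∀ i → i < suc m → arrs (exec body υ) 0 i ≡ arrs τ 4 i
    step m υ _ refl _ frᵃ h i i<1+m with m ≟ i
    ... | yes refl = trans (update-same (arrs υ 0) i (arrs υ 4 i)) (cong (λ f → f i) (frᵃ 4 tt))
    ... | no m≢i   = trans (update-≢ (arrs υ 0) m (arrs υ 4 m) i m≢i)
                       (h i (≤∧≢⇒< (s≤s⁻¹ i<1+m) (m≢i ∘ sym)))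

  module FromCut (w : ℕ) (w<n : w < n) where
    open AtCut w

    -- The sweep line starts at `suc σᶜ`: this makes the second slot, with end `σᶜ`, an empty one,
    -- and every arc in a window starts at or after it. The equations stand in for register contents
    -- that are only propositionally known.
    initial-inv : ∀ {sel i u s} → (∀ k → sel k ≡ 0) → i ≡ w → u ≡ B σᶜ i → s ≡ σᶜ →
      Inv (suc σᶜ) (sel [ i ↦ 1 ]) i u 1 i s 2
    initial-inv {sel} {i} {u} {s} zeros refl refl refl = record
      { proper = record { colours = colours ; support = support ; apart = apart }
      ; slot₀ = record { c≢0 = λ () ; c≤2 = s≤s z≤n
                       ; real = inj₂ (update-same sel i 1 , refl) ; rest = rest₀ }
      ; slot₁ = record { c≢0 = λ () ; c≤2 = ≤-refl ; real = inj₁ ≤-refl ; rest = rest₁ }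
      ; c₀≢c₁ = λ () }
      where
      colours : ∀ k → (sel [ i ↦ 1 ]) k ≤ 2
      colours k with update-cases sel i 1 k
      ... | inj₁ (_ , e) = ≤-trans (≤-reflexive e) (s≤s z≤n)
      ... | inj₂ (_ , e) = ≤-trans (≤-reflexive (trans e (zeros k))) z≤n
      only : ∀ k → (sel [ i ↦ 1 ]) k ≢ 0 → k ≡ i
      only k h with update-cases sel i 1 k
      ... | inj₁ (e , _) = e
      ... | inj₂ (_ , e) = ⊥-elim (h (trans e (zeros k)))
      support : ∀ k → (sel [ i ↦ 1 ]) k ≢ 0 → k < n × Unsevered σᶜ k
      support k h with only k h
      ... | refl = w<n , own-unsevered E<M S<M (S<M i) i refl
      apart : ∀ j k → j ≢ k → (sel [ i ↦ 1 ]) j ≡ (sel [ i ↦ 1 ]) k → (sel [ i ↦ 1 ]) j ≢ 0 →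
              B σᶜ j < A σᶜ k ⊎ B σᶜ k < A σᶜ j
      apart j k j≢k e h = ⊥-elim (j≢k (trans (only j h) (sym (only k (λ z → h (trans e z))))))
      rest₀ : ∀ k → (sel [ i ↦ 1 ]) k ≡ 1 → B σᶜ k < suc σᶜ ⊎ (k ≡ i × B σᶜ k ≡ B σᶜ i)
      rest₀ k h with only k (λ z → 1+n≢0 (trans (sym h) z))
      ... | refl = inj₂ (refl , refl)
      rest₁ : ∀ k → (sel [ i ↦ 1 ]) k ≡ 2 → B σᶜ k < suc σᶜ ⊎ (k ≡ i × B σᶜ k ≡ s)
      rest₁ k h with update-cases sel i 1 k
      ... | inj₁ (_ , e) = contradiction (trans (sym e) h) λ ()
      ... | inj₂ (_ , e) = contradiction (trans (sym (zeros k)) (trans (sym e) h)) λ ()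

    A-own : A σᶜ w ≡ σᶜ
    A-own = lift-0 ≤-refl

    B-own : B σᶜ w ≡ unwrapped w
    B-own = trans (cong (unwrapped w +_) (shift-0 {σᶜ} {S w} ≤-refl)) (+-identityʳ (unwrapped w))

    initial-dominates : ∀ {sel i} → (∀ k → sel k ≡ 0) → i ≡ w → ∀ Q (thin : Thin Q) → T (Q w) →
      Dominates Q thin (suc σᶜ) (sel [ i ↦ 1 ]) (λ k → k ≡ᵇ w)
    initial-dominates {sel} zeros refl Q thin Qw = record { member = member ; met = met ; ahead = ahead }
      where
      member : ∀ k → T (k ≡ᵇ w) → T (Q k) × A σᶜ k ≤ suc σᶜ
      member k h with ≡ᵇ⇒≡ k w h
      ... | refl = Qw , ≤-trans (≤-reflexive A-own) (n≤1+n σᶜ)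
      met : ∀ k → (sel [ w ↦ 1 ]) k ≢ 0 → T (Q k) → T (k ≡ᵇ w)
      met k h _ with update-cases sel w 1 k
      ... | inj₁ (e , _) = ≡⇒≡ᵇ k w e
      ... | inj₂ (_ , e) = ⊥-elim (h (trans e (zeros k)))
      ahead : ∀ t → count (early (λ k → k ≡ᵇ w) t) n ≤ count (early (chosen (sel [ w ↦ 1 ])) t) n
      ahead t = count-mono n go
        where
        go : ∀ k → k < n → T (early (λ k → k ≡ᵇ w) t k) → T (early (chosen (sel [ w ↦ 1 ])) t k)
        go k _ h with ≡ᵇ⇒≡ k w (∧-fst h)
        ... | refl = ∧-intro (subst (T ∘ nonzero) (sym (update-same sel k 1)) tt) (∧-snd {k ≡ᵇ k} h)

    passes-spec : ∀ {L} τ → Tables L τ → Listing L → regs τ 2 ≡ w → (∀ k → arrs τ 4 k ≡ 0) →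
      PassInv (λ j → j ≡ w ⊎ ∃ λ x → x < n × L x ≡ j × Window 0 j) M L n (exec passes (exec seed τ))
    passes-spec {L} τ t li reg-w zeros =
      pass-spec σ₃ t₃ li (Tables.reg-M t₂) (trans (exec-reg (for 3 0 visit) 8 tt σ₁) reg-σ) (inj₂ refl) base₂
      where
      σ₁ = exec (set 7 (con 0)) (exec seed τ)
      σ₂ = exec (for 3 0 visit) σ₁
      σ₃ = exec (set 7 (reg 1)) σ₂
      t₁ : Tables L σ₁
      t₁ = Tables-frame refl refl refl refl refl t
      t₂ : Tables L σ₂
      t₂ = Tables-frame (exec-reg (for 3 0 visit) 0 tt σ₁) (exec-reg (for 3 0 visit) 1 tt σ₁)
             (exec-arr (for 3 0 visit) 1 tt σ₁) (exec-arr (for 3 0 visit) 2 tt σ₁)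
             (exec-arr (for 3 0 visit) 3 tt σ₁) t₁
      t₃ : Tables L σ₃
      t₃ = Tables-frame refl refl refl refl refl t₂
      reg-σ : arrs τ 1 (regs τ 2) ≡ σᶜ
      reg-σ = trans (cong (arrs τ 1) reg-w) (Tables.arr-S t w w<n)
      base₁ : PassInv (_≡ w) 0 L 0 σ₁
      base₁ = record
        { cur = suc σᶜ
        ; inv = initial-inv zeros reg-w
            (trans (cong (arrs τ 2) reg-w) (trans (Tables.arr-U t w w<n)
              (trans (sym B-own) (cong (B σᶜ) (sym reg-w))))) reg-σ
        ; cur≤ = ≤-trans (S<M w) (m≤m+n M 0)
        ; upcoming = λ x _ _ ω → proj₁ ω
        ; optimal = λ Q thin Qw → (λ k → k ≡ᵇ w) , initial-dominates zeros reg-w Q thin Qw , met }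
        where
        met : ∀ {Q : ℕ → Bool} j → j ≡ w ⊎ (∃ λ x → x < 0 × L x ≡ j × Window 0 j) → T (Q j) → T (j ≡ᵇ w)
        met j (inj₁ e) _ = ≡⇒≡ᵇ j w e
      done₁ : PassInv (_≡ w) 0 L n σ₂
      done₁ = pass-spec σ₁ t₁ li refl reg-σ (inj₁ refl) base₁
      base₂ : PassInv (λ j → j ≡ w ⊎ ∃ λ x → x < n × L x ≡ j × Window 0 j) M L 0 σ₃
      base₂ = record
        { cur = cur ; inv = inv
        ; cur≤ = ≤-trans cur≤ (+-monoʳ-≤ M z≤n)
        -- Positions in the first pass are at most `M` and those in the second at least `M`, so the
        -- sweep line never moves back.
        ; upcoming = λ x _ _ _ → ≤-trans cur≤ (≤-trans (≤-reflexive (+-identityʳ M)) (m≤n+m M (S (L x))))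
        ; optimal = λ Q thin Qw → let q , d , met = optimal Q thin Qw in
            q , d , λ { j (inj₁ h) → met j h } }
        where open PassInv done₁

    cut-feasible : ∀ {D o L τ} → PassInv D o L n τ → Feasible (arrs τ 4)
    cut-feasible {τ = τ} p = (λ k _ → colours k) , λ j k _ _ → no-meet j k
      where
      open PassInv p
      open Proper (Inv.proper inv)
      no-meet : ∀ j k → j ≢ k → arrs τ 4 j ≡ arrs τ 4 k → arrs τ 4 j ≢ 0 → ¬ Meet j k
      no-meet j k j≢k e h meet
        with meet⇒overlap E<M S<M (S<M w) (proj₂ (support j h))
               (proj₂ (support k (λ z → h (trans e z)))) meet
           | apart j k j≢k e h
      ... | _ , k≤j | inj₁ lt = <⇒≱ lt k≤j
      ... | j≤k , _ | inj₂ lt = <⇒≱ lt j≤k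

    -- The deadline `σᶜ + M` lies after the end of every unsevered arc, so at this deadline `ahead`
    -- compares whole families.
    cut-optimal : ∀ {L τ} → Listing L →
      PassInv (λ j → j ≡ w ⊎ ∃ λ x → x < n × L x ≡ j × Window 0 j) M L n τ →
      ∀ Q → Candidate w Q → count Q n ≤ size (arrs τ 4)
    cut-optimal {L} {τ} li p Q (thin , Qw , members) with PassInv.optimal p Q thin Qw
    ... | q , d , met = begin
      count Q n                                      ≤⟨ count-mono n all-met ⟩
      count (early q (σᶜ + M)) n                     ≤⟨ Dominates.ahead d (σᶜ + M) ⟩
      count (early (chosen (arrs τ 4)) (σᶜ + M)) n   ≤⟨ count-mono n (λ k _ h → ∧-fst h) ⟩
      size (arrs τ 4)                                ∎
      where
      open ≤-Reasoning
      found : ∀ j → j < n → Unsevered σᶜ j → j ≡ w ⊎ S j ≢ σᶜ →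
        (j ≡ w ⊎ ∃ λ x → x < n × L x ≡ j × Window 0 j) ⊎ (∃ λ x → x < n × L x ≡ j × Window M j)
      found j j<n u (inj₁ e) = inj₁ (inj₁ e)
      found j j<n u (inj₂ ne) with Listing.covers li j j<n | shift-cases E<M S<M (S<M w) j
                                 | beyond-cut E<M S<M (S<M w) j ne
      ... | x , x<n , e | inj₁ o | b = inj₁ (inj₂ (x , x<n , e ,
              subst (λ y → σᶜ < S j + y) o b , subst (λ y → unwrapped j + y < σᶜ + M) o u))
      ... | x , x<n , e | inj₂ o | b = inj₂ (x , x<n , e ,
              subst (λ y → σᶜ < S j + y) o b , subst (λ y → unwrapped j + y < σᶜ + M) o u)
      all-met : ∀ j → j < n → T (Q j) → T (early q (σᶜ + M) j)
      all-met j j<n Qj with members j j<n Qj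
      ... | u , c = ∧-intro (met j (found j j<n u c) Qj) (<⇒<ᵇ u)

  record Best (w : ℕ) (τ : State) : Set where
    field
      feasible : Feasible (arrs τ 0)
      total    : size (arrs τ 0) ≡ regs τ 19
      best     : ∀ v → v < w → ∀ Q → Candidate v Q → count Q n ≤ regs τ 19
      blank    : ∀ k → arrs τ 4 k ≢ 0 → k < n

  Feasible-cong : ∀ {f g} → (∀ i → i < n → f i ≡ g i) → Feasible g → Feasible f
  Feasible-cong f≗g (colours , apart) =
    (λ k k<n → ≤-trans (≤-reflexive (f≗g k k<n)) (colours k k<n)) ,
    λ j k j<n k<n j≢k e h → apart j k j<n k<n j≢k
      (trans (sym (f≗g j j<n)) (trans e (f≗g k k<n))) (λ z → h (trans (f≗g j j<n) z))

  save-step : ∀ w τ υ → w < n → regs υ 0 ≡ n → regs υ 18 ≡ size (arrs υ 4) →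
    regs υ 19 ≡ regs τ 19 → arrs υ 0 ≡ arrs τ 0 → (∀ k → arrs υ 4 k ≢ 0 → k < n) →
    Feasible (arrs υ 4) → (∀ Q → Candidate w Q → count Q n ≤ size (arrs υ 4)) →
    Best w τ → Best (suc w) (exec save υ)
  save-step w τ υ w<n reg0 reg18 reg19 out≡ blank′ feasible′ optimal b =
    cond-≤ (Best (suc w)) (reg 18) (reg 19) nop (set 19 (reg 18) ⨟ copy) υ keep improve
    where
    open Best b
    best′ : ∀ {N} → regs υ 18 ≤ N → regs υ 19 ≤ N →
      ∀ v → v < suc w → ∀ Q → Candidate v Q → count Q n ≤ N
    best′ l₁ l₂ v v<1+w Q cand with m≤n⇒m<n∨m≡n (s≤s⁻¹ v<1+w)
    ... | inj₁ v<w  = ≤-trans (best v v<w Q cand) (≤-trans (≤-reflexive (sym reg19)) l₂)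
    ... | inj₂ refl = ≤-trans (optimal Q cand) (≤-trans (≤-reflexive (sym reg18)) l₁)
    keep : regs υ 18 ≤ regs υ 19 → Best (suc w) υ
    keep le = record
      { feasible = subst Feasible (sym out≡) feasible
      ; total    = trans (cong size out≡) (trans total (sym reg19))
      ; best     = best′ le ≤-refl
      ; blank    = blank′ }
    improve : regs υ 19 < regs υ 18 → Best (suc w) (exec (set 19 (reg 18) ⨟ copy) υ)
    improve lt = record
      { feasible = Feasible-cong out≗ feasible′
      ; total    = trans (count-cong n (λ k k<n → cong nonzero (out≗ k k<n)))
                     (trans (sym reg18) (sym new19))
      ; best     = best′ (≤-reflexive (sym new19)) (≤-trans (<⇒≤ lt) (≤-reflexive (sym new19)))
      ; blank    = λ k h → blank′ k (λ z → h (trans (cong (λ f → f k) (exec-arr copy 4 tt υ′)) z)) }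
      where
      υ′ = store 19 (regs υ 18) υ
      out≗ : ∀ k → k < n → arrs (exec copy υ′) 0 k ≡ arrs υ 4 k
      out≗ = copy-spec υ′ reg0
      new19 : regs (exec copy υ′) 19 ≡ regs υ 18
      new19 = exec-reg copy 19 tt υ′

  tally-step : ∀ {D o L} w τ υ → w < n → regs υ 0 ≡ n → regs υ 19 ≡ regs τ 19 →
    arrs υ 0 ≡ arrs τ 0 → AtCut.PassInv w D o L n υ →
    (∀ Q → Candidate w Q → count Q n ≤ size (arrs υ 4)) →
    Best w τ → Best (suc w) (exec save (exec tally υ))
  tally-step w τ υ w<n reg0 reg19 out≡ done optimal =
    save-step w τ (exec tally υ) w<n (trans (exec-reg tally 0 tt υ) reg0)
      (trans (tally-spec υ reg0) (cong size (sym sel≡)))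
      (trans (exec-reg tally 19 tt υ) reg19) (trans (exec-arr tally 0 tt υ) out≡)
      (λ k h → proj₁ (AtCut.Proper.support (AtCut.Inv.proper (AtCut.PassInv.inv done)) k
        (λ z → h (trans (cong (λ f → f k) sel≡) z))))
      (subst Feasible (sym sel≡) (FromCut.cut-feasible w w<n done))
      (subst (λ f → ∀ Q → Candidate w Q → count Q n ≤ size f) (sym sel≡) optimal)
    where
    sel≡ : arrs (exec tally υ) 4 ≡ arrs υ 4
    sel≡ = exec-arr tally 4 tt υ

  search-step : ∀ P {D o L} w τ → w < n → regs τ 0 ≡ n →
    T (keepsReg 0 P) → T (keepsReg 19 P) → T (keepsArr 0 P) →
    AtCut.PassInv w D o L n (exec P τ) →
    (∀ Q → Candidate w Q → count Q n ≤ size (arrs (exec P τ) 4)) →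
    Best w τ → Best (suc w) (exec (P ⨟ tally ⨟ save) τ)
  search-step P w τ w<n reg0 k₀ k₁₉ a₀ =
    tally-step w τ (exec P τ) w<n (trans (exec-reg P 0 k₀ τ) reg0) (exec-reg P 19 k₁₉ τ)
      (exec-arr P 0 a₀ τ)

  search-done : ∀ {L} w τ (w<n : w < n) → Tables L τ → Listing L → regs τ 2 ≡ w →
    (∀ k → arrs τ 4 k ≢ 0 → k < n) →
    AtCut.PassInv w (λ j → j ≡ w ⊎ ∃ λ x → x < n × L x ≡ j × AtCut.Window w 0 j) M L n
      (exec (clear ⨟ seed ⨟ passes) τ)
  search-done {L} w τ w<n t li reg-w blank =
    exec-three (AtCut.PassInv w (λ j → j ≡ w ⊎ ∃ λ x → x < n × L x ≡ j × AtCut.Window w 0 j) M L n)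
      clear seed passes τ
      (FromCut.passes-spec w w<n (exec clear τ)
        (Tables-frame (exec-reg clear 0 tt τ) (exec-reg clear 1 tt τ) (exec-arr clear 1 tt τ)
          (exec-arr clear 2 tt τ) (exec-arr clear 3 tt τ) t)
        li (trans (exec-reg clear 2 tt τ) reg-w) (clear-spec τ (Tables.reg-n t) blank))

  search-optimal : ∀ {L} w τ → w < n → Listing L →
    AtCut.PassInv w (λ j → j ≡ w ⊎ ∃ λ x → x < n × L x ≡ j × AtCut.Window w 0 j) M L n
      (exec (clear ⨟ seed ⨟ passes) τ) →
    ∀ Q → Candidate w Q → count Q n ≤ size (arrs (exec (clear ⨟ seed ⨟ passes) τ) 4)
  search-optimal {L} w τ w<n li done = FromCut.cut-optimal w w<n {L} {exec (clear ⨟ seed ⨟ passes) τ} li done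

  search-save-step : ∀ {L} w τ → w < n → Tables L τ → Best w τ →
    AtCut.PassInv w (λ j → j ≡ w ⊎ ∃ λ x → x < n × L x ≡ j × AtCut.Window w 0 j) M L n
             (exec (clear ⨟ seed ⨟ passes) τ) →
    (∀ Q → Candidate w Q → count Q n ≤ size (arrs (exec (clear ⨟ seed ⨟ passes) τ) 4)) →
    Best (suc w) (exec ((clear ⨟ seed ⨟ passes) ⨟ tally ⨟ save) τ)
  search-save-step w τ w<n t b done opt =
    search-step (clear ⨟ seed ⨟ passes) w τ w<n (Tables.reg-n t) tt tt tt done opt b

  cutAt-step : ∀ {L} w τ → w < n → Tables L τ → Listing L → regs τ 2 ≡ w →
    Best w τ → Best (suc w) (exec cutAt τ)
  cutAt-step {L} w τ w<n t li reg-w b =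
    exec-resp (Best (suc w)) ((clear ⨟ seed ⨟ passes) ⨟ tally ⨟ save) cutAt τ refl
      (search-save-step {L} w τ w<n t b
        (search-done {L} w τ w<n t li reg-w (Best.blank b))
        (search-optimal {L} w τ w<n li (search-done {L} w τ w<n t li reg-w (Best.blank b))))

  Best-relabel : ∀ {w} x υ → Best w υ → Best w (store 2 x υ)
  Best-relabel x υ b = record { feasible = feasible ; total = total ; best = best ; blank = blank }
    where open Best b

  -- `P` will be `cutAt`; as a variable it keeps `exec` from being unfolded, as in `exec-three`.
  cuts-generic : ∀ P {L} τ → T (keepsReg 2 P) → T (keepsReg 0 P) → T (keepsReg 1 P) →
    T (keepsArr 1 P) → T (keepsArr 2 P) → T (keepsArr 3 P) →
    (∀ w υ → w < n → Tables L υ → regs υ 2 ≡ w → Best w υ → Best (suc w) (exec P υ)) →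
    Tables L τ → Best 0 τ → Best n (exec (for 2 0 P) τ)
  cuts-generic P τ k₂ k₀ k₁ a₁ a₂ a₃ step t base =
    subst (λ w → Best w (exec (for 2 0 P) τ)) (Tables.reg-n t)
      (for-invariant 2 0 P τ Best k₂ (Best-relabel 0 τ base)
        (λ w υ w<N reg-w frʳ frᵃ b → Best-relabel (regs (exec P υ) 2 + 1) (exec P υ)
          (step w υ (subst (w <_) (Tables.reg-n t) w<N)
            (Tables-frame (frʳ 0 k₀) (frʳ 1 k₁) (frᵃ 1 a₁) (frᵃ 2 a₂) (frᵃ 3 a₃) t) reg-w b)))

  cuts-spec : ∀ {L} τ → Tables L τ → Listing L → (∀ k → arrs τ 0 k ≡ 0) → (∀ k → arrs τ 4 k ≡ 0) →
    regs τ 19 ≡ 0 → Best n (exec (for 2 0 cutAt) τ)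
  cuts-spec {L} τ t li out-zero sel-zero reg19 =
    cuts-generic cutAt τ tt tt tt tt tt tt
      (λ w υ w<n t′ reg-w b → cutAt-step w υ w<n t′ li reg-w b) t base
    where
    base : Best 0 τ
    base = record
      { feasible = (λ k _ → ≤-trans (≤-reflexive (out-zero k)) z≤n)
                 , (λ j _ _ _ _ _ h → ⊥-elim (h (out-zero j)))
      ; total = trans (count-none n (λ k _ h → nonzero⇒≢0 h (out-zero k))) (sym reg19)
      ; best  = λ _ ()
      ; blank = λ k h → ⊥-elim (h (sel-zero k)) }

  -- Bucket sort of the arcs by start

  record Sorting (p i : ℕ) (τ : State) : Set where
    field
      -- Buckets below `p` are complete and arcs below `i` have been scanned for bucket `p`. The
      -- exact length is what identifies the filled positions with those below `n` at the end.
      length : regs τ 6 ≡ count (λ k → S k <ᵇ p) n + count (λ k → S k ≡ᵇ p) i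
      within : ∀ x → x < regs τ 6 → arrs τ 3 x < n × S (arrs τ 3 x) ≤ p
      sorted : ∀ x y → x ≤ y → y < regs τ 6 → S (arrs τ 3 x) ≤ S (arrs τ 3 y)
      covers : ∀ j → j < n → S j < p ⊎ (S j ≡ p × j < i) → ∃ λ x → x < regs τ 6 × arrs τ 3 x ≡ j

  Sorting-next : ∀ {p τ} → Sorting p n τ → Sorting (suc p) 0 τ
  Sorting-next {p} {τ} s = record
    { length = trans length (trans (sym (count-sum {λ k → S k <ᵇ suc p} n (λ k → bit-split (S k) p)))
                 (sym (+-identityʳ (count (λ k → S k <ᵇ suc p) n))))
    ; within = λ x h → proj₁ (within x h) , m≤n⇒m≤1+n (proj₂ (within x h))
    ; sorted = sorted
    ; covers = cov }
    where
    open Sorting s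
    cov : ∀ j → j < n → S j < suc p ⊎ (S j ≡ suc p × j < 0) → ∃ λ x → x < regs τ 6 × arrs τ 3 x ≡ j
    cov j j<n (inj₁ h) with m≤n⇒m<n∨m≡n (s≤s⁻¹ h)
    ... | inj₁ lt = covers j j<n (inj₁ lt)
    ... | inj₂ e  = covers j j<n (inj₂ (e , j<n))

  Sorting-skip : ∀ {p i τ} → S i ≢ p → Sorting p i τ → Sorting p (suc i) τ
  Sorting-skip {p} {i} {τ} ne s = record
    { length = trans length (cong (λ b → count (λ k → S k <ᵇ p) n + (b + count (λ k → S k ≡ᵇ p) i))
                 (sym (bit-false (λ h → ne (≡ᵇ⇒≡ (S i) p h)))))
    ; within = within ; sorted = sorted ; covers = cov }
    where
    open Sorting s
    cov : ∀ j → j < n → S j < p ⊎ (S j ≡ p × j < suc i) → ∃ λ x → x < regs τ 6 × arrs τ 3 x ≡ j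
    cov j j<n (inj₁ h) = covers j j<n (inj₁ h)
    cov j j<n (inj₂ (e , h)) with m≤n⇒m<n∨m≡n (s≤s⁻¹ h)
    ... | inj₁ j<i  = covers j j<n (inj₂ (e , j<i))
    ... | inj₂ refl = ⊥-elim (ne e)

  -- The new last entry has start `p`, and `within` bounds all earlier starts by `p`, so the order
  -- survives.
  Sorting-append : ∀ {p i τ} → i < n → S i ≡ p → Sorting p i τ →
    Sorting p (suc i) ⟪ regs τ [ 6 ↦ suc (regs τ 6) ] , arrs τ [ 3 ↦ arrs τ 3 [ regs τ 6 ↦ i ] ] ⟫
  Sorting-append {p} {i} {τ} i<n e s = record
    { length = trans (cong suc length) (trans (sym (+-suc _ _))
        (cong (λ b → count (λ k → S k <ᵇ p) n + (b + count (λ k → S k ≡ᵇ p) i))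
          (sym (bit-true (≡⇒≡ᵇ (S i) p e)))))
    ; within = wit ; sorted = sor ; covers = cov }
    where
    open Sorting s
    C = regs τ 6
    L = arrs τ 3
    at : ∀ x → x < suc C → (x ≡ C × (L [ C ↦ i ]) x ≡ i) ⊎ (x < C × (L [ C ↦ i ]) x ≡ L x)
    at x h with m≤n⇒m<n∨m≡n (s≤s⁻¹ h)
    ... | inj₁ lt   = inj₂ (lt , update-≢ L C i x (>⇒≢ lt))
    ... | inj₂ refl = inj₁ (refl , update-same L C i)
    wit : ∀ x → x < suc C → (L [ C ↦ i ]) x < n × S ((L [ C ↦ i ]) x) ≤ p
    wit x h with at x h
    ... | inj₁ (_ , f)  = subst (_< n) (sym f) i<n , ≤-reflexive (trans (cong S f) e)
    ... | inj₂ (lt , f) = subst (_< n) (sym f) (proj₁ (within x lt)) ,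
                          ≤-trans (≤-reflexive (cong S f)) (proj₂ (within x lt))
    sor : ∀ x y → x ≤ y → y < suc C → S ((L [ C ↦ i ]) x) ≤ S ((L [ C ↦ i ]) y)
    sor x y x≤y h with at y h
    ... | inj₁ (_ , f) = ≤-trans (proj₂ (wit x (≤-<-trans x≤y h)))
                           (≤-reflexive (trans (sym e) (cong S (sym f))))
    ... | inj₂ (lt , f) = ≤-trans (≤-reflexive (cong S (update-≢ L C i x (>⇒≢ (≤-<-trans x≤y lt)))))
                            (≤-trans (sorted x y x≤y lt) (≤-reflexive (cong S (sym f))))
    cov : ∀ j → j < n → S j < p ⊎ (S j ≡ p × j < suc i) → ∃ λ x → x < suc C × (L [ C ↦ i ]) x ≡ j
    cov j j<n h with j ≟ i
    ... | yes refl = C , ≤-refl , update-same L C i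
    ... | no j≢i with covers j j<n (old h)
      where
      old : S j < p ⊎ (S j ≡ p × j < suc i) → S j < p ⊎ (S j ≡ p × j < i)
      old (inj₁ lt) = inj₁ lt
      old (inj₂ (f , lt)) = inj₂ (f , ≤∧≢⇒< (s≤s⁻¹ lt) j≢i)
    ...   | x , lt , f = x , m<n⇒m<1+n lt , trans (update-≢ L C i x (>⇒≢ lt)) f

  sort-step : ∀ p i τ → i < n → regs τ 2 ≡ p → regs τ 3 ≡ i → arrs τ 1 i ≡ S i →
    Sorting p i τ → Sorting p (suc i) (exec sort-inner τ)
  sort-step p i τ i<n refl refl arr-S s =
    cond-≤ (Sorting p (suc i)) (arr 1 (reg 3)) (reg 2)
      (cond (reg 2 ≤ⁿ arr 1 (reg 3)) (put 3 (reg 6) (reg 3) ⨟ increment 6) nop) nop τ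
      (λ le → cond-≤ (Sorting p (suc i)) (reg 2) (arr 1 (reg 3))
        (put 3 (reg 6) (reg 3) ⨟ increment 6) nop τ
        (λ ge → Sorting-append i<n (≤-antisym (subst (_≤ p) arr-S le) (subst (p ≤_) arr-S ge)) s)
        (λ lt → Sorting-skip (λ e → <⇒≢ (subst (_< p) arr-S lt) e) s))
      (λ gt → Sorting-skip (λ e → >⇒≢ (subst (p <_) arr-S gt) e) s)

  sort-spec : ∀ τ → regs τ 0 ≡ n → regs τ 1 ≡ M → (∀ i → i < n → arrs τ 1 i ≡ S i) →
    Listing (arrs (exec sortStarts τ) 3)
  sort-spec τ reg-n reg-M arr-S = record
    { within = λ x x<n → proj₁ (within x (bound x<n))
    ; sorted = λ x y x≤y y<n → sorted x y x≤y (bound y<n)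
    ; covers = λ j j<n → let x , lt , e = covers j j<n (inj₁ (S<M j)) in
        x , subst (x <_) full lt , e }
    where
    τ₁ = store 6 0 τ
    outer = for 3 0 sort-inner
    relabel₂ : ∀ {p i x υ} → Sorting p i υ → Sorting p i (store 2 x υ)
    relabel₂ s = record { length = length ; within = within ; sorted = sorted ; covers = covers }
      where open Sorting s
    relabel₃ : ∀ {p i x υ} → Sorting p i υ → Sorting p i (store 3 x υ)
    relabel₃ s = record { length = length ; within = within ; sorted = sorted ; covers = covers }
      where open Sorting s
    base : Sorting 0 0 (store 2 0 τ₁)
    base = record
      { length = sym (trans (+-identityʳ _) (count-none n (λ k _ h → n≮0 (<ᵇ⇒< (S k) 0 h))))
      ; within = λ _ () ; sorted = λ _ _ _ () ; covers = λ { _ _ (inj₁ ()) ; _ _ (inj₂ (_ , ())) } }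
    inner : ∀ p υ → regs υ 0 ≡ n → regs υ 2 ≡ p → arrs υ 1 ≡ arrs τ 1 →
      Sorting p 0 υ → Sorting p n (exec outer υ)
    inner p υ r₀ r₂ a₁ s = subst (λ i → Sorting p i (exec outer υ)) r₀
      (for-invariant 3 0 sort-inner υ (Sorting p) tt (relabel₃ s)
        (λ i χ i<N r₃ frʳ frᵃ s′ → let i<n = subst (i <_) r₀ i<N in
          relabel₃ (sort-step p i χ i<n (trans (frʳ 2 tt) r₂) r₃
            (trans (cong (λ f → f i) (trans (frᵃ 1 tt) a₁)) (arr-S i i<n)) s′)))
    final : Sorting M 0 (exec sortStarts τ)
    final = subst (λ p → Sorting p 0 (exec sortStarts τ)) reg-M
      (for-invariant 2 1 outer τ₁ (λ p → Sorting p 0) tt base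
        (λ p υ _ r₂ frʳ frᵃ s → relabel₂ (Sorting-next
          (inner p υ (trans (frʳ 0 tt) reg-n) r₂ (frᵃ 1 tt) s))))
    open Sorting final
    full : regs (exec sortStarts τ) 6 ≡ n
    full = trans length (trans (+-identityʳ _) (count-all n (λ k _ → <⇒<ᵇ (S<M k))))
    bound : ∀ {x} → x < n → x < regs (exec sortStarts τ) 6
    bound {x} = subst (x <_) (sym full)

-- Ranks of the endpoints

module Ranks {c ℓ₁ ℓ₂} (O : DecTotalOrder c ℓ₁ ℓ₂) {n} (arcs : Fin n → Arc O) where
  open Semantics O arcs
  open DecTotalOrder O using (Carrier)

  startAt endAt : ℕ → Maybe Carrier
  startAt i = Maybe.map Arc.start (arcAt O arcs i)
  endAt i   = Maybe.map Arc.end (arcAt O arcs i)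

  rank : Maybe Carrier → ℕ → ℕ
  rank v k = count (λ j → not (compare O arcs v (startAt j))) k
           + count (λ j → not (compare O arcs v (endAt j))) k

  -- There are 2n endpoints, so ranks range from 0 to 2n and `M` exceeds them all. An index outside
  -- the input yields `nothing`, for which every comparison fails; its rank is 2n, so the bounds
  -- hold for all indices.
  M : ℕ
  M = suc (n + n)

  S E : ℕ → ℕ
  S i = rank (startAt i) n
  E i = rank (endAt i) n

  rank<M : ∀ v → rank v n < M
  rank<M v = s≤s (+-mono-≤ (count≤ _ n) (count≤ _ n))

  open Circle M S E using (unwrapped)

  tally-one : ∀ t x τ →
    regs (exec (cond t nop (increment x)) τ) x ≡ bit (not (⟦_⟧ᵗ O arcs t τ)) + regs τ x
  tally-one t x τ with ⟦_⟧ᵗ O arcs t τ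
  ... | true  = refl
  ... | false = update-same (regs τ) x (suc (regs τ x))

  -- The hypothesis on `p` says that it depends on the state only through register 2, which the
  -- counting loop leaves alone; so the same value `v` is compared in every iteration.
  rankOf-spec : ∀ p y v σ → regs σ 0 ≡ n → (∀ τ → regs τ 2 ≡ regs σ 2 → ⟦_⟧ᵖ O arcs p τ ≡ v) →
    regs (exec (rankOf p y) σ) (4 + y) ≡ rank v n
  rankOf-spec p y v σ reg-n p≡ = subst (λ k → regs (exec (rankOf p y) σ) (4 + y) ≡ rank v k) reg-n
    (for-invariant 3 0 body (store (4 + y) 0 σ) (λ k τ → regs τ (4 + y) ≡ rank v k) tt
      (update-same (regs σ) (4 + y) 0) step)
    where
    tally₁ tally₂ body : Prog
    tally₁ = cond (p ≤ᵖ startOf (reg 3)) nop (increment (4 + y))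
    tally₂ = cond (p ≤ᵖ endOf (reg 3)) nop (increment (4 + y))
    body = tally₁ ⨟ tally₂
    regroup : ∀ a b x z → b + (a + (x + z)) ≡ (a + x) + (b + z)
    regroup a b x z = trans (cong (b +_) (sym (+-assoc a x z)))
      (trans (sym (+-assoc b (a + x) z)) (trans (cong (_+ z) (+-comm b (a + x))) (+-assoc (a + x) b z)))
    step : ∀ k τ → k < regs σ 0 → regs τ 3 ≡ k →
      (∀ x → T (keepsReg x (for 3 0 body)) → regs τ x ≡ regs (store (4 + y) 0 σ) x) →
      (∀ a → T (keepsArr a body) → arrs τ a ≡ arrs σ a) →
      regs τ (4 + y) ≡ rank v k → regs (exec body τ) (4 + y) ≡ rank v (suc k)
    step k τ _ reg-k frʳ _ h = begin
      regs (exec body τ) (4 + y)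
        ≡⟨ tally-one (p ≤ᵖ endOf (reg 3)) (4 + y) (exec tally₁ τ) ⟩
      bit (not (⟦_⟧ᵗ O arcs (p ≤ᵖ endOf (reg 3)) (exec tally₁ τ))) + regs (exec tally₁ τ) (4 + y)
        ≡⟨ cong₂ _+_
             (cong₂ (λ a i → bit (not (compare O arcs a (endAt i))))
               (p≡ (exec tally₁ τ) (trans (exec-reg tally₁ 2 tt τ) (frʳ 2 tt)))
               (trans (exec-reg tally₁ 3 tt τ) reg-k))
             (tally-one (p ≤ᵖ startOf (reg 3)) (4 + y) τ) ⟩
      bit (not (compare O arcs v (endAt k)))
        + (bit (not (⟦_⟧ᵗ O arcs (p ≤ᵖ startOf (reg 3)) τ)) + regs τ (4 + y))
        ≡⟨ cong₂ (λ a b → bit (not (compare O arcs v (endAt k))) + (a + b))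
             (cong₂ (λ a i → bit (not (compare O arcs a (startAt i)))) (p≡ τ (frʳ 2 tt)) reg-k) h ⟩
      bit (not (compare O arcs v (endAt k)))
        + (bit (not (compare O arcs v (startAt k))) + rank v k)
        ≡⟨ regroup (bit (not (compare O arcs v (startAt k)))) (bit (not (compare O arcs v (endAt k)))) _ _ ⟩
      rank v (suc k) ∎
      where open ≡-Reasoning

  Ranked : ℕ → State → Set
  Ranked k τ = ∀ i → i < k → arrs τ 1 i ≡ S i × arrs τ 2 i ≡ unwrapped i

  rank-store-spec : ∀ k τ → regs τ 1 ≡ M → regs τ 2 ≡ k → regs τ 4 ≡ S k → regs τ 5 ≡ E k →
    Ranked k τ → Ranked (suc k) (exec rank-store τ)
  rank-store-spec k τ reg-M refl reg-S reg-E h =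
    cond-≤ (λ υ → Ranked (suc k) (exec (put 2 (reg 2) (reg 5)) υ)) (reg 4) (reg 5) nop
      (set 5 (reg 5 ⊕ reg 1)) τ₁
      (λ le → write _ (trans reg-E
        (sym (Circle.unwrapped-plain M S E (subst₂ _≤_ reg-S reg-E le)))))
      (λ gt → write _ (trans (cong₂ _+_ reg-E reg-M)
        (sym (Circle.unwrapped-wrap M S E (subst₂ _<_ reg-E reg-S gt)))))
    where
    τ₁ = exec (put 1 (reg 2) (reg 4)) τ
    write : ∀ u → u ≡ unwrapped k → ∀ i → i < suc k →
      (arrs τ 1 [ k ↦ regs τ 4 ]) i ≡ S i × (arrs τ 2 [ k ↦ u ]) i ≡ unwrapped i
    write u e i i<1+k with k ≟ i
    ... | yes refl = trans (update-same (arrs τ 1) i (regs τ 4)) reg-S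
                   , trans (update-same (arrs τ 2) i u) e
    ... | no k≢i = let old = h i (≤∧≢⇒< (s≤s⁻¹ i<1+k) (k≢i ∘ sym)) in
      trans (update-≢ (arrs τ 1) k (regs τ 4) i k≢i) (proj₁ old) ,
      trans (update-≢ (arrs τ 2) k u i k≢i) (proj₂ old)

  rankAll-generic : ∀ P₁ P₂ τ k → T (keepsReg 1 (P₁ ⨟ P₂)) → T (keepsReg 2 (P₁ ⨟ P₂)) →
    T (keepsReg 4 P₂) → T (keepsArr 1 (P₁ ⨟ P₂)) → T (keepsArr 2 (P₁ ⨟ P₂)) →
    regs τ 1 ≡ M → regs τ 2 ≡ k → regs (exec P₁ τ) 4 ≡ S k → regs (exec P₂ (exec P₁ τ)) 5 ≡ E k →
    Ranked k τ → Ranked (suc k) (exec rank-store (exec P₂ (exec P₁ τ)))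
  rankAll-generic P₁ P₂ τ k k₁ k₂ k₄ a₁ a₂ reg-M reg-k reg-S reg-E h =
    rank-store-spec k (exec P₂ (exec P₁ τ)) (trans (exec-reg (P₁ ⨟ P₂) 1 k₁ τ) reg-M)
      (trans (exec-reg (P₁ ⨟ P₂) 2 k₂ τ) reg-k)
      (trans (exec-reg P₂ 4 k₄ (exec P₁ τ)) reg-S) reg-E
      (λ i i<k → let old = h i i<k in
        trans (cong (λ f → f i) (exec-arr (P₁ ⨟ P₂) 1 a₁ τ)) (proj₁ old) ,
        trans (cong (λ f → f i) (exec-arr (P₁ ⨟ P₂) 2 a₂ τ)) (proj₂ old))

  rankAll-spec : ∀ σ → regs σ 0 ≡ n → regs σ 1 ≡ M → Ranked n (exec rankAll σ)
  rankAll-spec σ reg-n reg-M = subst (λ k → Ranked k (exec rankAll σ)) reg-n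
    (for-invariant 2 0 body σ Ranked tt (λ _ ()) step)
    where
    rank₁ rank₂ body : Prog
    rank₁ = rankOf (startOf (reg 2)) 0
    rank₂ = rankOf (endOf (reg 2)) 1
    body = rank₁ ⨟ rank₂ ⨟ rank-store
    step : ∀ k τ → k < regs σ 0 → regs τ 2 ≡ k →
      (∀ x → T (keepsReg x (for 2 0 body)) → regs τ x ≡ regs σ x) →
      (∀ a → T (keepsArr a body) → arrs τ a ≡ arrs σ a) →
      Ranked k τ → Ranked (suc k) (exec body τ)
    step k τ _ reg-k frʳ _ h = rankAll-generic rank₁ rank₂ τ k tt tt tt tt tt
      (trans (frʳ 1 tt) reg-M) reg-k
      (rankOf-spec (startOf (reg 2)) 0 (startAt k) τ reg0
        (λ υ e → cong startAt (trans e reg-k)))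
      (rankOf-spec (endOf (reg 2)) 1 (endAt k) (exec rank₁ τ) (trans (exec-reg rank₁ 0 tt τ) reg0)
        (λ υ e → cong endAt (trans e (trans (exec-reg rank₁ 2 tt τ) reg-k))))
      h
      where
      reg0 : regs τ 0 ≡ n
      reg0 = trans (frʳ 0 tt) reg-n

  open Cuts O arcs M S E (λ k → rank<M (endAt k)) (λ k → rank<M (startAt k))

  main-spec : ∀ σ → regs σ 0 ≡ n → regs σ 1 ≡ M → regs σ 19 ≡ 0 → (∀ a k → arrs σ a k ≡ 0) →
    Best n (exec main σ)
  main-spec σ reg-n reg-M reg19 zeros =
    exec-resp (Best n) (rankAll ⨟ sortStarts ⨟ for 2 0 cutAt) main σ refl
      (exec-three (Best n) rankAll sortStarts (for 2 0 cutAt) σ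
        (cuts-spec {arrs τ₂ 3} τ₂
          (record
            { reg-n = trans (exec-reg sortStarts 0 tt τ₁) reg-n₁
            ; reg-M = trans (exec-reg sortStarts 1 tt τ₁) reg-M₁
            ; arr-S = λ i i<n → trans (cong (λ f → f i) (exec-arr sortStarts 1 tt τ₁)) (proj₁ (ranked i i<n))
            ; arr-U = λ i i<n → trans (cong (λ f → f i) (exec-arr sortStarts 2 tt τ₁)) (proj₂ (ranked i i<n))
            ; arr-L = λ i → refl })
          (sort-spec τ₁ reg-n₁ reg-M₁ (λ i i<n → proj₁ (ranked i i<n)))
          (λ k → trans (cong (λ f → f k) (trans (exec-arr sortStarts 0 tt τ₁) (exec-arr rankAll 0 tt σ)))
                       (zeros 0 k))
          (λ k → trans (cong (λ f → f k) (trans (exec-arr sortStarts 4 tt τ₁) (exec-arr rankAll 4 tt σ)))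
                       (zeros 4 k))
          (trans (exec-reg sortStarts 19 tt τ₁) (trans (exec-reg rankAll 19 tt σ) reg19))))
    where
    τ₁ τ₂ : State
    τ₁ = exec rankAll σ
    τ₂ = exec sortStarts τ₁
    ranked : Ranked n τ₁
    ranked = rankAll-spec σ reg-n reg-M
    reg-n₁ : regs τ₁ 0 ≡ n
    reg-n₁ = trans (exec-reg rankAll 0 tt σ) reg-n
    reg-M₁ : regs τ₁ 1 ≡ M
    reg-M₁ = trans (exec-reg rankAll 1 tt σ) reg-M

-- Circular-arc graphs

module Geometry {c ℓ₁ ℓ₂ g} (O : DecTotalOrder c ℓ₁ ℓ₂) {n} (G : Graph (Fin n) g)
  (arcs : Fin n → Arc O) (rep : Represents O arcs G) where

  open Ranks O arcs
  open DecTotalOrder O using (Carrier; total) renaming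
    (_≤_ to _≤ᴼ_; _≤?_ to _≤ᴼ?_; trans to ≤ᴼ-trans; refl to ≤ᴼ-refl)
  open Circle M S E
  open Cuts O arcs M S E (λ k → rank<M (endAt k)) (λ k → rank<M (startAt k))

  E<M : ∀ k → E k < M
  E<M k = rank<M (endAt k)

  S<M : ∀ k → S k < M
  S<M k = rank<M (startAt k)

  start end : Fin n → Carrier
  start i = Arc.start (arcs i)
  end i   = Arc.end (arcs i)

  arcAt-toℕ : ∀ i → arcAt O arcs (toℕ i) ≡ just (arcs i)
  arcAt-toℕ i with toℕ i <? n
  ... | yes p = cong (just ∘ arcs) (fromℕ<-toℕ i p)
  ... | no ¬p = ⊥-elim (¬p (toℕ<n i))

  startAt-toℕ : ∀ i → startAt (toℕ i) ≡ just (start i)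
  startAt-toℕ i = cong (Maybe.map Arc.start) (arcAt-toℕ i)

  endAt-toℕ : ∀ i → endAt (toℕ i) ≡ just (end i)
  endAt-toℕ i = cong (Maybe.map Arc.end) (arcAt-toℕ i)

  rk : Carrier → ℕ
  rk x = rank (just x) n

  S≡ : ∀ i → S (toℕ i) ≡ rk (start i)
  S≡ i = cong (λ v → rank v n) (startAt-toℕ i)

  E≡ : ∀ i → E (toℕ i) ≡ rk (end i)
  E≡ i = cong (λ v → rank v n) (endAt-toℕ i)

  above-mono : ∀ {x y} v → x ≤ᴼ y →
    T (not (compare O arcs (just x) v)) → T (not (compare O arcs (just y) v))
  above-mono nothing  x≤y h = tt
  above-mono {x} {y} (just z) x≤y h =
    fromWitnessFalse {a? = y ≤ᴼ? z} (λ y≤z → toWitnessFalse {a? = x ≤ᴼ? z} h (≤ᴼ-trans x≤y y≤z))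

  rk-mono : ∀ {x y} → x ≤ᴼ y → rk x ≤ rk y
  rk-mono x≤y = +-mono-≤ (count-mono n (λ k _ → above-mono (startAt k) x≤y))
                         (count-mono n (λ k _ → above-mono (endAt k) x≤y))

  Endpointᴼ : Carrier → Set c
  Endpointᴼ y = ∃ λ j → y ≡ start j ⊎ y ≡ end j

  ≰⇒≥ᴼ : ∀ {x y} → ¬ x ≤ᴼ y → y ≤ᴼ x
  ≰⇒≥ᴼ {x} {y} h with total x y
  ... | inj₁ p = ⊥-elim (h p)
  ... | inj₂ p = p

  -- Ranks only see endpoints, hence the restriction on `y`: being an endpoint, `y` is itself
  -- counted in the rank of `x` but not in its own.
  rk-strict : ∀ {x y} → Endpointᴼ y → ¬ x ≤ᴼ y → rk y < rk x
  rk-strict {x} {y} (j , y≡) x≰y = strict y≡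
    where
    y≤x = ≰⇒≥ᴼ x≰y
    at : ∀ v → v ≡ just y → ¬ T (not (compare O arcs (just y) v)) × T (not (compare O arcs (just x) v))
    at .(just y) refl = (λ h → toWitnessFalse {a? = y ≤ᴼ? y} h ≤ᴼ-refl) , fromWitnessFalse {a? = x ≤ᴼ? y} x≰y
    strict : y ≡ start j ⊎ y ≡ end j → rk y < rk x
    strict (inj₁ refl) = let a = at (startAt (toℕ j)) (startAt-toℕ j) in
      +-mono-<-≤ (count-insert n (toℕ j) (toℕ<n j) (proj₁ a) (proj₂ a) (λ k _ → above-mono (startAt k) y≤x))
                 (count-mono n (λ k _ → above-mono (endAt k) y≤x))
    strict (inj₂ refl) = let a = at (endAt (toℕ j)) (endAt-toℕ j) in
      +-mono-≤-< (count-mono n (λ k _ → above-mono (startAt k) y≤x))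
                 (count-insert n (toℕ j) (toℕ<n j) (proj₁ a) (proj₂ a) (λ k _ → above-mono (endAt k) y≤x))

  rk-reflect : ∀ {x y} → Endpointᴼ y → rk x ≤ rk y → x ≤ᴼ y
  rk-reflect {x} {y} e h with x ≤ᴼ? y
  ... | yes p = p
  ... | no ¬p = ⊥-elim (<⇒≱ (rk-strict e ¬p) h)

  startᴼ : ∀ i → Endpointᴼ (start i)
  startᴼ i = i , inj₁ refl

  endᴼ : ∀ i → Endpointᴼ (end i)
  endᴼ i = i , inj₂ refl

  ∈ᵃ⇒onArc : ∀ i j → _∈ᵃ_ O (start i) (arcs j) → S (toℕ i) onArc toℕ j
  ∈ᵃ⇒onArc i j h rewrite S≡ i | S≡ j | E≡ j with h
  ... | inj₁ (a , b , d)     = inj₁ (rk-mono a , rk-mono b , rk-mono d)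
  ... | inj₂ (a , inj₁ b)    = inj₂ (rk-strict (endᴼ j) a , inj₁ (rk-mono b))
  ... | inj₂ (a , inj₂ b)    = inj₂ (rk-strict (endᴼ j) a , inj₂ (rk-mono b))

  onArc⇒∈ᵃ : ∀ i j → S (toℕ i) onArc toℕ j → _∈ᵃ_ O (start i) (arcs j)
  onArc⇒∈ᵃ i j h rewrite S≡ i | S≡ j | E≡ j with h
  ... | inj₁ (a , b , d)     =
    inj₁ (rk-reflect (endᴼ j) a , rk-reflect (startᴼ i) b , rk-reflect (endᴼ j) d)
  ... | inj₂ (a , inj₁ b)    = inj₂ ((λ s≤e → <⇒≱ a (rk-mono s≤e)) , inj₁ (rk-reflect (startᴼ i) b))
  ... | inj₂ (a , inj₂ b)    = inj₂ ((λ s≤e → <⇒≱ a (rk-mono s≤e)) , inj₂ (rk-reflect (endᴼ j) b))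

  -- Move backwards from the common point: both arcs persist until one of them reaches its start,
  -- and that start still lies on the other.
  intersect⇒start : ∀ A B → Intersect O A B →
    _∈ᵃ_ O (Arc.start A) B ⊎ _∈ᵃ_ O (Arc.start B) A
  intersect⇒start A B (x , inA , inB) with total (Arc.start A) (Arc.start B) | inA | inB
  ... | inj₁ p | inj₁ (a , b , d) | inj₁ (_ , f , _) = inj₂ (inj₁ (a , p , ≤ᴼ-trans f d))
  ... | inj₂ p | inj₁ (a , b , d) | inj₁ (e , _ , f) = inj₁ (inj₁ (e , p , ≤ᴼ-trans b f))
  ... | inj₁ p | inj₂ (a , _)     | _                = inj₂ (inj₂ (a , inj₁ p))
  ... | inj₂ p | inj₂ (a , inj₁ b) | inj₁ (e , _ , f) = inj₁ (inj₁ (e , p , ≤ᴼ-trans b f))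
  ... | inj₂ p | inj₂ (a , inj₂ b) | inj₁ (e , f , _) = inj₂ (inj₂ (a , inj₂ (≤ᴼ-trans f b)))
  ... | inj₂ p | _                | inj₂ (e , _)     = inj₁ (inj₂ (e , inj₁ p))
  ... | inj₁ p | inj₁ (a , b , d) | inj₂ (e , inj₁ f) = inj₂ (inj₁ (a , p , ≤ᴼ-trans f d))
  ... | inj₁ p | inj₁ (a , b , d) | inj₂ (e , inj₂ f) = inj₁ (inj₂ (e , inj₂ (≤ᴼ-trans b f)))

  adj⇒meet : ∀ i j → Adj G i j → Meet (toℕ i) (toℕ j)
  adj⇒meet i j a with intersect⇒start (arcs i) (arcs j)
    (Equivalence.to (rep i j (λ { refl → Graph.irrefl G refl a })) a)
  ... | inj₁ h = inj₁ (∈ᵃ⇒onArc i j h)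
  ... | inj₂ h = inj₂ (∈ᵃ⇒onArc j i h)

  common⇒adj : ∀ x i j → i ≢ j → S (toℕ x) onArc toℕ i → S (toℕ x) onArc toℕ j → Adj G i j
  common⇒adj x i j i≢j hi hj =
    Equivalence.from (rep i j i≢j) (start x , onArc⇒∈ᵃ x i hi , onArc⇒∈ᵃ x j hj)

  pigeonhole : ∀ {x y z : Bool} → x ≢ y → x ≢ z → y ≢ z → ⊥
  pigeonhole {false} {false}         p q r = p refl
  pigeonhole {false} {true}  {false} p q r = q refl
  pigeonhole {false} {true}  {true}  p q r = r refl
  pigeonhole {true}  {true}          p q r = p refl
  pigeonhole {true}  {false} {true}  p q r = q refl
  pigeonhole {true}  {false} {false} p q r = r refl

  module _ (OPT : Subset n) (bip : Bipartite (induced G OPT)) where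

    Q : ℕ → Bool
    Q = indicator OPT

    -- Arcs through a common point are pairwise adjacent, and three vertices cannot receive pairwise
    -- different sides out of two.
    no-triple : ∀ x i j k → i ≢ j → i ≢ k → j ≢ k → x < n → T (Q i) → T (Q j) → T (Q k) →
      S x onArc i → S x onArc j → S x onArc k → ⊥
    no-triple x i j k i≢j i≢k j≢k x<n Qi Qj Qk hi hj hk
      with toℕ (fromℕ< x<n) | toℕ-fromℕ< x<n | common⇒adj (fromℕ< x<n)
    ... | _ | refl | adj with indicator-∈ OPT {i} Qi | indicator-∈ OPT {j} Qj | indicator-∈ OPT {k} Qk
    ...   | i′ , refl , mi | j′ , refl , mj | k′ , refl , mk = pigeonhole
      (proj₂ bip {i′ , mi} {j′ , mj} (adj i′ j′ (i≢j ∘ cong toℕ) hi hj))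
      (proj₂ bip {i′ , mi} {k′ , mk} (adj i′ k′ (i≢k ∘ cong toℕ) hi hk))
      (proj₂ bip {j′ , mj} {k′ , mk} (adj j′ k′ (j≢k ∘ cong toℕ) hj hk))

    module _ (w : ℕ) (w<n : w < n) (Qw : T (Q w)) where

      σ : ℕ
      σ = S w

      usable : ℕ → Bool
      usable k = (B σ k <ᵇ σ + M) ∧ ((k ≡ᵇ w) ∨ not (S k ≡ᵇ σ))

      usable-intro : ∀ k → Unsevered σ k → k ≡ w ⊎ S k ≢ σ → T (usable k)
      usable-intro k u (inj₁ e) = ∧-intro (<⇒<ᵇ u) (Equivalence.from T-∨ (inj₁ (≡⇒≡ᵇ k w e)))
      usable-intro k u (inj₂ ne) = ∧-intro (<⇒<ᵇ u)
        (Equivalence.from (T-∨ {k ≡ᵇ w}) (inj₂ (not-T λ h → ne (≡ᵇ⇒≡ (S k) σ h))))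

      usable-elim : ∀ k → T (usable k) → Unsevered σ k × (k ≡ w ⊎ S k ≢ σ)
      usable-elim k h = <ᵇ⇒< (B σ k) (σ + M) (∧-fst h) ,
        side (Equivalence.to (T-∨ {k ≡ᵇ w}) (∧-snd {B σ k <ᵇ σ + M} h))
        where
        side : T (k ≡ᵇ w) ⊎ T (not (S k ≡ᵇ σ)) → k ≡ w ⊎ S k ≢ σ
        side (inj₁ p) = inj₁ (≡ᵇ⇒≡ k w p)
        side (inj₂ p) = inj₂ (λ e → T-not p (≡⇒≡ᵇ (S k) σ e))

      -- Either the arc is severed and reaches the cut, or it is an arc other than `w` that starts
      -- there; in both cases it contains `σ`.
      unusable : ∀ k → ¬ T (usable k) → k ≢ w × σ onArc k
      unusable k h = k≢w , on
        where
        k≢w : k ≢ w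
        k≢w refl = h (usable-intro k (own-unsevered E<M S<M (S<M w) k refl) (inj₁ refl))
        on : σ onArc k
        on with B σ k <? σ + M | S k ≟ σ
        ... | no ¬u | _     = severed-∋cut E<M S<M (S<M w) k ¬u
        ... | yes u | yes e = subst (_onArc k) e (start-∋ E<M S<M (S<M w) k)
        ... | yes u | no ne = ⊥-elim (h (usable-intro k u (inj₂ ne)))

      Q′ : ℕ → Bool
      Q′ k = Q k ∧ usable k

      -- `A σ x` is by definition the lift of `S x`, so three intervals over it would be three arcs
      -- of `Q` through the point `S x`.
      candidate : Candidate w Q′
      candidate = thin
        , ∧-intro Qw (usable-intro w (own-unsevered E<M S<M (S<M w) w refl) (inj₁ refl))
        , λ j _ h → usable-elim j (∧-snd {Q j} h)
        where
        on : ∀ x i → T (Q′ i) → A σ i ≤ A σ x × A σ x ≤ B σ i → S x onArc i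
        on x i h (l , r) = lift⇒onArc E<M S<M (S<M w) (S<M x)
          (proj₁ (usable-elim i (∧-snd {Q i} h))) l r
        thin : AtCut.Thin w Q′
        thin x i j k x<n _ _ _ _ i≢j i≢k j≢k Qi Qj Qk hi hj hk =
          no-triple x i j k i≢j i≢k j≢k x<n (∧-fst Qi) (∧-fst Qj) (∧-fst Qk)
            (on x i Qi hi) (on x j Qj hj) (on x k Qk hk)

      -- Two unusable members would contain the start of `w` together with `w` itself, which
      -- `no-triple` forbids.
      lose-one : count Q n ≤ suc (count Q′ n)
      lose-one = ≤-trans (count-union {q = Q′} n split) (+-monoˡ-≤ (count Q′ n) (count≤1 n single))
        where
        rest : ℕ → Bool
        rest k = Q k ∧ not (usable k)
        split : ∀ k → k < n → T (Q k) → T (rest k) ⊎ T (Q′ k)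
        split k _ h with usable k
        ... | true  = inj₂ (∧-intro h tt)
        ... | false = inj₁ (∧-intro h tt)
        bad : ∀ k → T (rest k) → T (Q k) × k ≢ w × σ onArc k
        bad k h = ∧-fst h , unusable k (λ u → T-not (∧-snd {Q k} h) u)
        single : ∀ i j → i < n → j < n → i ≢ j → T (rest i) → T (rest j) → ⊥
        single i j _ _ i≢j hi hj = let Qi , i≢w , oi = bad i hi ; Qj , j≢w , oj = bad j hj in
          no-triple w i j w i≢j i≢w j≢w w<n Qi Qj Qw oi oj (start-∋ E<M S<M (S<M w) w)

    -- If `Q` is empty the claim is trivial. Otherwise any member can play `w`, because the search
    -- has tried every cut.
    near-optimal : ∀ τ → Best n τ → count Q n ≤ suc (size (arrs τ 0))
    near-optimal τ b with count Q n in eq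
    ... | zero  = z≤n
    ... | suc m with count-pick {Q} n {m} (≤-reflexive (sym eq))
    ...   | w , w<n , Qw , _ = ≤-trans (≤-reflexive (sym eq)) (≤-trans (lose-one w w<n Qw)
              (s≤s (≤-trans (Best.best b w w<n (Q′ w w<n Qw) (candidate w w<n Qw))
                            (≤-reflexive (sym (Best.total b))))))

  output-lookup : ∀ τ i → lookup (output n τ) i ≡ nonzero (arrs τ 0 (toℕ i))
  output-lookup τ i = lookup∘tabulate _ i

  output-size : ∀ τ → ∣ output n τ ∣ ≡ size (arrs τ 0)
  output-size τ = ∣∣≡count (output n τ) (λ k → nonzero (arrs τ 0 k)) (output-lookup τ)

  output-bipartite : ∀ τ → Feasible (arrs τ 0) → Bipartite (induced G (output n τ))
  output-bipartite τ (colours , apart) = (λ v → colour v ≡ᵇ 1) , λ {u} {v} a same →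
    apart (toℕ (proj₁ u)) (toℕ (proj₁ v)) (toℕ<n (proj₁ u)) (toℕ<n (proj₁ v))
      (λ e → Graph.irrefl G (toℕ-injective e) a)
      (determined (colour≢0 u) (colour≢0 v) (colours _ (toℕ<n (proj₁ u))) (colours _ (toℕ<n (proj₁ v))) same)
      (colour≢0 u) (adj⇒meet (proj₁ u) (proj₁ v) a)
    where
    colour : ∃ (_∈ output n τ) → ℕ
    colour v = arrs τ 0 (toℕ (proj₁ v))
    colour≢0 : ∀ v → colour v ≢ 0
    colour≢0 (i , m) = nonzero⇒≢0
      (Equivalence.from T-≡ (trans (sym (output-lookup τ i)) ([]=⇒lookup m)))
    determined : ∀ {x y} → x ≢ 0 → y ≢ 0 → x ≤ 2 → y ≤ 2 → (x ≡ᵇ 1) ≡ (y ≡ᵇ 1) → x ≡ y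
    determined {0} p q h k e = ⊥-elim (p refl)
    determined {suc _} {0} p q h k e = ⊥-elim (q refl)
    determined {1} {1} p q h k e = refl
    determined {2} {2} p q h k e = refl
    determined {suc (suc (suc _))} p q (s≤s (s≤s ())) k e
    determined {y = suc (suc (suc _))} p q h (s≤s (s≤s ())) e

-- Quadratic time bound and conclusion

time : ℕ → ℕ
-- The first instruction, which computes `M`, costs 6, and sequencing it costs 1. The base
-- `suc (n + n)` is `M`, and 2 is the value of `degree main`.
time n = 1 + 6 + factor main * suc (n + n) ^ 2

*-square : ∀ a b → (a * b) ^ 2 ≡ a ^ 2 * b ^ 2
*-square a b = begin
  a * b * (a * b * 1)        ≡⟨ cong (a * b *_) (*-identityʳ (a * b)) ⟩
  a * b * (a * b)            ≡⟨ interchange a b a b ⟩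
  a * a * (b * b)            ≡⟨ cong₂ (λ x y → a * x * (b * y)) (*-identityʳ a) (*-identityʳ b) ⟨
  a * (a * 1) * (b * (b * 1)) ∎
  where
  open ≡-Reasoning
  open import Algebra.Properties.CommutativeSemigroup *-commutativeSemigroup using (interchange)

-- For `n ≥ 1`, 2n + 1 is at most 3n, whence the factor `3 ^ 2` and the threshold 1. A variable `F`
-- keeps the numeral `factor main` out of the calculation.
time-quadratic : ∀ F → (λ n → 1 + 6 + F * suc (n + n) ^ 2) ∈O (λ n → n ^ 2)
time-quadratic F = 7 + F * 3 ^ 2 , 1 , bound
  where
  open ≤-Reasoning
  bound : ∀ n → 1 ≤ n → 7 + F * suc (n + n) ^ 2 ≤ (7 + F * 3 ^ 2) * n ^ 2
  bound n 1≤n = begin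
    7 + F * suc (n + n) ^ 2
      ≤⟨ +-mono-≤ (*-monoʳ-≤ 7 (^-monoˡ-≤ 2 1≤n))
           (*-monoʳ-≤ F (^-monoˡ-≤ 2 (+-monoˡ-≤ (n + n) 1≤n))) ⟩
    7 * n ^ 2 + F * (n + (n + n)) ^ 2
      -- `3 * n` unfolds to `n + (n + (n + 0))`, so only the final zero has to be supplied.
      ≡⟨ cong (λ x → 7 * n ^ 2 + F * (n + (n + x)) ^ 2) (sym (+-identityʳ n)) ⟩
    7 * n ^ 2 + F * (3 * n) ^ 2
      ≡⟨ cong (λ x → 7 * n ^ 2 + F * x) (*-square 3 n) ⟩
    7 * n ^ 2 + F * (3 ^ 2 * n ^ 2)
      ≡⟨ cong (7 * n ^ 2 +_) (sym (*-assoc F (3 ^ 2) (n ^ 2))) ⟩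
    7 * n ^ 2 + F * 3 ^ 2 * n ^ 2
      ≡⟨ sym (*-distribʳ-+ (n ^ 2) 7 (F * 3 ^ 2)) ⟩
    (7 + F * 3 ^ 2) * n ^ 2 ∎

theorem5 : ∀ {c ℓ₁ ℓ₂ g} →
    ∃ λ (P : Program) → ∃ λ (T : ℕ → ℕ) → T ∈O (λ n → n ^ 2) ×
    (∀ (O : DecTotalOrder c ℓ₁ ℓ₂) (n : ℕ) (G : Graph (Fin n) g)
    (arcs : Fin n → Arc O) → Represents O arcs G →
    ∃ λ σ → ∃ λ t → Run O arcs P (initial n) t σ × t ≤ T n ×
    Bipartite (induced G (output n σ)) ×
    (∀ OPT → IsMaximumInducedBipartite G OPT →
    ∣ output n σ ∣ ≥ ∣ OPT ∣ ∸ 1))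
theorem5 = program , time , time-quadratic (factor main) , correct
  where
  correct : ∀ O n G arcs → Represents O arcs G →
    ∃ λ σ → ∃ λ t → Run O arcs program (initial n) t σ × t ≤ time n ×
    Bipartite (induced G (output n σ)) ×
    (∀ OPT → IsMaximumInducedBipartite G OPT → ∣ output n σ ∣ ≥ ∣ OPT ∣ ∸ 1)
  correct O n G arcs rep =
    τ , _ , run-⨾ run-≔ (proj₁ (proj₂ ran)) , +-monoʳ-≤ 7 (proj₂ (proj₂ ran)) ,
    output-bipartite τ (C.Best.feasible best) ,
    λ OPT max → ≤-trans
      (∸-monoˡ-≤ 1 (≤-trans (≤-reflexive (∣∣≡count OPT (indicator OPT) (indicator-lookup OPT)))
                            (near-optimal OPT (proj₁ max) τ best)))
      (≤-reflexive (sym (output-size τ)))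
    where
    open Semantics O arcs
    open Geometry O G arcs rep
    open Ranks O arcs using (M; S; E; rank<M; startAt; endAt; main-spec)
    module C = Cuts O arcs M S E (λ k → rank<M (endAt k)) (λ k → rank<M (startAt k))
    σ₁ τ : State
    σ₁ = store 1 (suc (n + n)) (initial n)
    τ = exec main σ₁
    bounds : ∀ b → T (b <ᵇ 2) → regs σ₁ b ≤ suc (n + n)
    bounds zero       _ = ≤-trans (m≤m+n n n) (n≤1+n (n + n))
    bounds (suc zero) _ = ≤-refl
    -- `wf main` evaluates to `true`, so `tt` proves well-formedness, and `degree main` evaluates to
    -- the exponent in `time`.
    ran = run main tt (suc (n + n)) σ₁ bounds
    best : C.Best n τ
    best = main-spec σ₁ refl refl refl (λ _ _ → refl)
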